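{- Given an instance $I$ of offline line aggregation with deadlines with $n$ requests, the dynamic programming algorithm described in the context computes an optimal offline solution for $I$ (together with its cost) in $O(n^3)$ time and $O(n^2)$ space.
   Context: Offline line aggregation with deadlines (LAD). An instance $I$ is a finite sequence of $n$ requests; each request $r$ has release time $a_r\ge0$, location $x_r>0$ and deadline $d_r\ge a_r$, all known in advance. A solution is a finite set of services $(t,y)$ (time $t$, location $y\ge0$), each with cost $y$. It is feasible if for every request $r$ there is a service $(t,y)$ in it with $a_r\le t\le d_r$ and $y\ge x_r$ (the service covers $r$). The cost of a solution is the sum of the costs of its services; an optimal solution is a feasible solution of minimum cost. The algorithm. Sort the distinct deadlines as $\tau_1<\dots<\tau_m$ and set $\tau_0=-\infty$, $\tau_{m+1}=+\infty$. For $0\le i<j\le m+1$ let $I(i,j)=\{r\in I: a_r>\tau_i,\ d_r<\tau_j\}$. If $I(i,j)\ne\varnothing$, choose $p(i,j)\in\arg\max_{r\in I(i,j)}x_r$ and, writing $p=p(i,j)$, let $$K(i,j)=\{k: i<k<j,\ a_p\le\tau_k\le d_p,\ d_r=\tau_k\text{ for some } r\in I(i,j)\}.$$ For $w=1,\dots,m+1$ and $i=0,\dots,m+1-w$, with $j=i+w$: determine by one scan over the requests whether $I(i,j)$ is empty and, if not, find $p(i,j)$ and $K(i,j)$. If $I(i,j)=\varnothing$, set $F[i,j]=0$ and $\mathrm{split}[i,j]=\mathrm{pivot}[i,j]=\bot$ (a sentinel meaning "no value"). Otherwise pick $k^\star\in\arg\min_{k\in K(i,j)}\{F[i,k]+F[k,j]\}$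 and set $F[i,j]=x_{p(i,j)}+F[i,k^\star]+F[k^\star,j]$, $\mathrm{split}[i,j]=k^\star$, $\mathrm{pivot}[i,j]=p(i,j)$. Finally return $F[0,m+1]$ and $X^\star=\mathrm{Build}(0,m+1)$, where $\mathrm{Build}(i,j)=\varnothing$ if $\mathrm{split}[i,j]=\bot$, and otherwise, with $k=\mathrm{split}[i,j]$ and $p=\mathrm{pivot}[i,j]$, $\mathrm{Build}(i,j)=\mathrm{Build}(i,k)\cup\{(\tau_k,x_p)\}\cup\mathrm{Build}(k,j)$. Time and space are counted in the unit-cost model: arithmetic operations and comparisons on times and locations, and table accesses, take constant time, and each number occupies one unit of space. -}

module Defs where

open import Algebra.Structures using (IsAbelianGroup)
open import Data.Bool.Base using (Bool; true; false; not; _∧_; if_then_else_)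
open import Data.List.Base using (List; []; _∷_; _∷ʳ_; foldr)
open import Data.List.Relation.Unary.All using (All)
open import Data.List.Relation.Unary.Any using (Any)
open import Data.List.Relation.Unary.Unique.Propositional using (Unique)
open import Data.Maybe.Base using (Maybe; just; nothing)
open import Data.Nat.Base as ℕ using (ℕ; zero; suc; _⊔_; _∸_; _<ᵇ_; _≡ᵇ_)
open import Data.Product.Base using (_×_; _,_; proj₁; proj₂; ∃-syntax)
open import Data.Unit.Base using (⊤; tt)
open import Data.Vec.Base using (Vec; []; _∷_)
open import Data.Vec.Relation.Unary.All as Vec using ()
open import Relation.Binary.Core using (Rel)
open import Relation.Binary.Definitions using (WeaklyDecidable)
open import Relation.Binary.PropositionalEquality.Core using (_≡_; _≢_; refl)
open import Relation.Binary.Structures using (IsDecTotalOrder)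
open import Relation.Nullary.Construct.Add.Extrema using (_±; ⊥±; [_]; ⊤±)
open import Relation.Nullary.Decidable.Core using (does)
open import Level using (0ℓ)

------------------------------------------------------------------------
-- Numbers
--
-- Times and locations are elements of an arbitrary totally ordered abelian
-- group whose order can be tested: the unit-cost model grants comparisons
-- and additions of numbers and nothing else.  The real numbers with the
-- comparison oracle of that model are an instance, as are ℚ and ℤ.

record OrderedGroup : Set₁ where
  infix  4 _≤_ _<_
  infixl 6 _+_
  field
    Carrier         : Set
    _≤_             : Rel Carrier 0ℓ
    _+_             : Carrier → Carrier → Carrier
    0#              : Carrier
    -_              : Carrier → Carrier
    isAbelianGroup  : IsAbelianGroup _≡_ _+_ 0# -_
    isDecTotalOrder : IsDecTotalOrder _≡_ _≤_
    +-monoʳ-≤       : ∀ x {y z} → y ≤ z → x + y ≤ x + z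

  _<_ : Rel Carrier 0ℓ
  x < y = x ≤ y × x ≢ y

  open IsDecTotalOrder isDecTotalOrder public using (_≤?_)

------------------------------------------------------------------------
-- Line aggregation with deadlines

module LAD (R : OrderedGroup) where
  open OrderedGroup R

  record Request : Set where
    field
      release  : Carrier
      location : Carrier
      deadline : Carrier
      release≥0        : 0# ≤ release
      location>0       : 0# < location
      deadline≥release : release ≤ deadline
  open Request public

  Instance : ℕ → Set
  Instance n = Vec Request n

  -- A service (t , y): time t, location y.
  Service : Set
  Service = Carrier × Carrier

  -- A finite set of services is a list without repetitions.
  record IsSolution (S : List Service) : Set where
    field
      distinct    : Unique S
      locations≥0 : All (λ s → 0# ≤ proj₂ s) S

  cost : List Service → Carrier
  cost = foldr (λ s c → proj₂ s + c) 0#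

  _covers_ : Service → Request → Set
  (t , y) covers r = release r ≤ t × t ≤ deadline r × location r ≤ y

  record IsFeasible {n} (I : Instance n) (S : List Service) : Set where
    field
      isSolution : IsSolution S
      covered    : Vec.All (λ r → Any (_covers r) S) I

  record IsOptimal {n} (I : Instance n) (S : List Service) : Set where
    field
      isFeasible : IsFeasible I S
      minimum    : ∀ S′ → IsFeasible I S′ → cost S ≤ cost S′

------------------------------------------------------------------------
-- A unit-cost language
--
-- Programs are polymorphic in the type V of numbers and the type N of
-- indices, so they can only compute with them through the primitives of
-- `Prog`, each of which is charged below; between two primitives there is
-- only a bounded case distinction on results already obtained.  Register
-- types are drawn from the universe `Ty`, so that every local variable and
-- every table entry occupies a fixed number of words.

data Ty : Set where
  unit bool nat num : Ty
  ext               : Ty             -- numbers together with ±∞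
  opt               : Ty → Ty        -- values together with the sentinel ⊥
  pair              : Ty → Ty → Ty

words : Ty → ℕ
words unit       = 0
words bool       = 1
words nat        = 1
words num        = 1
words ext        = 1
words (opt s)    = suc (words s)
words (pair s t) = words s ℕ.+ words t

module _ (V N : Set) where
  Val : Ty → Set
  Val unit       = ⊤
  Val bool       = Bool
  Val nat        = N
  Val num        = V
  Val ext        = V ±
  Val (opt s)    = Maybe (Val s)
  Val (pair s t) = Val s × Val t

-- Tables are two-dimensional; a one-dimensional table has the single row 0.
-- `rank` holds, for each request r, the k with d_r = τ_k, and `mark` holds
-- the set of those k with d_r = τ_k for some r ∈ I(i,j), for the current
-- (i,j).
data Table : Set where
  rel loc dl          : Table        -- the input
  τ rank mark         : Table
  F split pivot       : Table

entryTy : Table → Ty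
entryTy rel   = num
entryTy loc   = num
entryTy dl    = num
entryTy τ     = ext
entryTy rank  = nat
entryTy mark  = bool
entryTy F     = num
entryTy split = opt nat
entryTy pivot = opt nat

data Prog (V N : Set) : Ty → Set where
  ret   : ∀ {t} → Val V N t → Prog V N t
  _>>=_ : ∀ {s t} → Prog V N s → (Val V N s → Prog V N t) → Prog V N t
  abort : ∀ {t} → Prog V N t
  -- `loop lo hi s body` runs body for lo ≤ k < hi, threading a register
  -- initialised to s.
  loop  : ∀ {s} → N → N → Val V N s → (N → Val V N s → Prog V N s) → Prog V N s
  -- `call i j` invokes the (single) recursive procedure.
  call  : N → N → Prog V N unit
  -- An arbitrary choice.
  flip  : Prog V N bool
  lit   : ℕ → Prog V N nat
  add   : N → N → Prog V N nat
  sub   : N → N → Prog V N nat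
  zeroⱽ : Prog V N num
  addⱽ  : V → V → Prog V N num
  leqⱽ  : V → V → Prog V N bool
  -- `alloc T rows columns v` creates the table T with all entries v.
  alloc : (T : Table) → N → N → Val V N (entryTy T) → Prog V N unit
  read  : (T : Table) → N → N → Prog V N (entryTy T)
  write : (T : Table) → N → N → Val V N (entryTy T) → Prog V N unit
  -- `emit t y` appends the service (t , y) to the output.
  emit  : V → V → Prog V N unit

infixl 1 _>>=_ _>>_

_>>_ : ∀ {V N t} → Prog V N unit → Prog V N t → Prog V N t
p >> q = p >>= λ _ → q

-- The number of words charged for one activation record; it exceeds the
-- number of words of local variables that are in scope together at any
-- point of the programs below.
frame : ℕ
frame = 64

sameTable : WeaklyDecidable (_≡_ {A = Table})
sameTable rel   rel   = just refl
sameTable loc   loc   = just refl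
sameTable dl    dl    = just refl
sameTable τ     τ     = just refl
sameTable rank  rank  = just refl
sameTable mark  mark  = just refl
sameTable F     F     = just refl
sameTable split split = just refl
sameTable pivot pivot = just refl
sameTable _     _     = nothing

module Semantics (R : OrderedGroup) where
  open OrderedGroup R
  open LAD R

  Value : Ty → Set
  Value = Val Carrier ℕ

  Code : Ty → Set
  Code = Prog Carrier ℕ

  record State : Set where
    constructor state
    field
      size   : Table → ℕ × ℕ         -- rows and columns
      entry  : (T : Table) → ℕ → ℕ → Value (entryTy T)
      output : List Service
      time   : ℕ
      heap   : ℕ                     -- words in tables and in the output
      depth  : ℕ                     -- active procedure invocations
      space  : ℕ                     -- largest number of words in use so far
  open State public

  tick : ℕ → State → State
  tick k σ = record σ { time = k ℕ.+ time σ }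

  record-space : State → State
  record-space σ = record σ { space = space σ ⊔ (heap σ ℕ.+ frame ℕ.* depth σ) }

  inBounds : State → Table → ℕ → ℕ → Bool
  inBounds σ T i j = (i <ᵇ proj₁ (size σ T)) ∧ (j <ᵇ proj₂ (size σ T))

  setSize : Table → ℕ × ℕ → (Table → ℕ × ℕ) → Table → ℕ × ℕ
  setSize T rc f T′ with sameTable T T′
  ... | just _  = rc
  ... | nothing = f T′

  setAll : (T : Table) → Value (entryTy T) →
           ((T′ : Table) → ℕ → ℕ → Value (entryTy T′)) →
           (T′ : Table) → ℕ → ℕ → Value (entryTy T′)
  setAll T v f T′ i j with sameTable T T′
  ... | just refl = v
  ... | nothing   = f T′ i j

  setEntry : (T : Table) → ℕ → ℕ → Value (entryTy T) →
             ((T′ : Table) → ℕ → ℕ → Value (entryTy T′)) →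
             (T′ : Table) → ℕ → ℕ → Value (entryTy T′)
  setEntry T i j v f T′ i′ j′ with sameTable T T′
  ... | just refl = if (i ≡ᵇ i′) ∧ (j ≡ᵇ j′) then v else f T i′ j′
  ... | nothing   = f T′ i′ j′

  -- The choice made by a `flip` executed at time t is `choice t`.  Distinct
  -- flips happen at distinct times, so quantifying over `choice` quantifies
  -- over all ways of making the choices.
  --
  -- The result is `nothing` if the execution aborts, accesses a table out of
  -- bounds, or exceeds the recursion depth `fuel`.
  module Run (choice : ℕ → Bool) (proc : ℕ → ℕ → Code unit) where

    run     : ∀ {t} → ℕ → Code t → State → Maybe (Value t × State)
    iterate : ∀ {s} → ℕ → (count k : ℕ) → (ℕ → Value s → Code s) →
              Value s → State → Maybe (Value s × State)

    run fuel (ret v) σ = just (v , σ)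
    run fuel (p >>= f) σ with run fuel p σ
    ... | nothing       = nothing
    ... | just (v , σ′) = run fuel (f v) σ′
    run fuel abort σ = nothing
    run fuel (loop lo hi s body) σ =
      iterate fuel (hi ∸ lo) lo body s (tick 1 σ)
    run zero (call i j) σ = nothing
    run (suc fuel) (call i j) σ
      with run fuel (proc i j)
             (record-space (tick 1 (record σ { depth = suc (depth σ) })))
    ... | nothing       = nothing
    ... | just (v , σ′) = just (v , record σ′ { depth = depth σ })
    run fuel flip σ = just (choice (time σ) , tick 1 σ)
    run fuel (lit k) σ = just (k , tick 1 σ)
    run fuel (add i j) σ = just (i ℕ.+ j , tick 1 σ)
    run fuel (sub i j) σ = just (i ∸ j , tick 1 σ)
    run fuel zeroⱽ σ = just (0# , tick 1 σ)
    run fuel (addⱽ x y) σ = just (x + y , tick 1 σ)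
    run fuel (leqⱽ x y) σ = just (does (x ≤? y) , tick 1 σ)
    run fuel (alloc T r c v) σ = just (tt , record-space (tick (suc (r ℕ.* c))
      (record σ { size  = setSize T (r , c) (size σ)
                ; entry = setAll T v (entry σ)
                ; heap  = heap σ ℕ.+ words (entryTy T) ℕ.* (r ℕ.* c) })))
    run fuel (read T i j) σ =
      if inBounds σ T i j then just (entry σ T i j , tick 1 σ) else nothing
    run fuel (write T i j v) σ =
      if inBounds σ T i j
      then just (tt , tick 1 (record σ { entry = setEntry T i j v (entry σ) }))
      else nothing
    run fuel (emit t y) σ = just (tt , record-space (tick 1
      (record σ { output = output σ ∷ʳ (t , y) ; heap = heap σ ℕ.+ 2 })))

    iterate fuel zero        k body s σ = just (s , σ)
    iterate fuel (suc count) k body s σ with run fuel (body k s) (tick 1 σ)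
    ... | nothing        = nothing
    ... | just (s′ , σ′) = iterate fuel count (suc k) body s′ σ′

  -- Entries outside the bounds of the table are never accessed.
  column : ∀ {n} → (Request → Carrier) → Vec Request n → ℕ → Carrier
  column f []      _       = 0#
  column f (r ∷ I) zero    = f r
  column f (r ∷ I) (suc k) = column f I k

  initial : ∀ {n} → Instance n → State
  initial {n} I = state size₀ entry₀ [] 0 (3 ℕ.* n) 1 (3 ℕ.* n ℕ.+ frame)
    where
    size₀ : Table → ℕ × ℕ
    size₀ rel = 1 , n
    size₀ loc = 1 , n
    size₀ dl  = 1 , n
    size₀ _   = 0 , 0

    entry₀ : (T : Table) → ℕ → ℕ → Value (entryTy T)
    entry₀ rel   _ k = column release I k
    entry₀ loc   _ k = column location I k
    entry₀ dl    _ k = column deadline I k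
    entry₀ τ     _ _ = ⊥±
    entry₀ rank  _ _ = 0
    entry₀ mark  _ _ = false
    entry₀ F     _ _ = 0#
    entry₀ split _ _ = nothing
    entry₀ pivot _ _ = nothing

------------------------------------------------------------------------
-- The dynamic program

module Algorithm {V N : Set} where

  private
    P : Ty → Set
    P = Prog V N

    T⟦_⟧ : Ty → Set
    T⟦_⟧ = Val V N

  alloc₁ : (T : Table) → N → T⟦ entryTy T ⟧ → P unit
  alloc₁ T c v = do
    r ← lit 1
    alloc T r c v

  read₁ : (T : Table) → N → P (entryTy T)
  read₁ T k = do
    z ← lit 0
    read T z k

  write₁ : (T : Table) → N → T⟦ entryTy T ⟧ → P unit
  write₁ T k v = do
    z ← lit 0
    write T z k v

  for : N → N → (N → P unit) → P unit
  for lo hi body = loop lo hi tt λ k _ → body k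

  ltⱽ : V → V → P bool
  ltⱽ x y = do
    b ← leqⱽ y x
    ret (not b)

  infix 4 _≤ᵉ_ _<ᵉ_

  _≤ᵉ_ : T⟦ ext ⟧ → T⟦ ext ⟧ → P bool
  ⊥±    ≤ᵉ _     = ret true
  _     ≤ᵉ ⊤±    = ret true
  [ x ] ≤ᵉ [ y ] = leqⱽ x y
  _     ≤ᵉ _     = ret false

  _<ᵉ_ : T⟦ ext ⟧ → T⟦ ext ⟧ → P bool
  s <ᵉ t = do
    b ← t ≤ᵉ s
    ret (not b)

  -- Does x come before y, with ties resolved arbitrarily?
  before : V → V → P bool
  before x y = do
    x≤y ← leqⱽ x y
    y≤x ← leqⱽ y x
    if x≤y ∧ y≤x then flip else ret x≤y

  -- The smallest deadline greater than t.
  nextDeadline : N → T⟦ ext ⟧ → P (opt num)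
  nextDeadline n t = do
    z ← lit 0
    loop z n nothing λ r best → do
      d ← read₁ dl r
      later ← t <ᵉ [ d ]
      if later then improve d best else ret best
    where
    improve : V → T⟦ opt num ⟧ → P (opt num)
    improve d nothing  = ret (just d)
    improve d (just b) = do
      smaller ← ltⱽ d b
      ret (just (if smaller then d else b))

  setRanks : N → N → V → P unit
  setRanks n k t = do
    z ← lit 0
    for z n λ r → do
      d ← read₁ dl r
      d≤t ← leqⱽ d t
      t≤d ← leqⱽ t d
      if d≤t ∧ t≤d then write₁ rank r k else ret tt

  -- Fills τ_0 < τ_1 < … < τ_m < τ_{m+1} and returns m.
  sortDeadlines : N → P nat
  sortDeadlines n = do
    z ← lit 0
    write₁ τ z ⊥±
    m ← loop z n z λ _ m → do
      t ← read₁ τ m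
      next ← nextDeadline n t
      extend m next
    one ← lit 1
    m+1 ← add m one
    write₁ τ m+1 ⊤±
    ret m
    where
    extend : N → T⟦ opt num ⟧ → P nat
    extend m nothing  = ret m
    extend m (just t) = do
      one ← lit 1
      k ← add m one
      write₁ τ k [ t ]
      setRanks n k t
      ret k

  -- Scans the requests, marking the k with d_r = τ_k for some r ∈ I(i,j),
  -- and returns p(i,j) with its location, or ⊥ if I(i,j) is empty.
  scan : N → N → N → P (opt (pair nat num))
  scan n i j = do
    τi ← read₁ τ i
    τj ← read₁ τ j
    for i j λ k → write₁ mark k false
    z ← lit 0
    loop z n nothing λ r best → do
      a ← read₁ rel r
      d ← read₁ dl r
      inside₁ ← τi <ᵉ [ a ]
      inside₂ ← [ d ] <ᵉ τj
      if inside₁ ∧ inside₂ then visit r best else ret best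
    where
    improve : N → V → T⟦ opt (pair nat num) ⟧ → P (opt (pair nat num))
    improve r x nothing        = ret (just (r , x))
    improve r x (just (q , y)) = do
      larger ← before y x
      ret (just (if larger then (r , x) else (q , y)))

    visit : N → T⟦ opt (pair nat num) ⟧ → P (opt (pair nat num))
    visit r best = do
      k ← read₁ rank r
      write₁ mark k true
      x ← read₁ loc r
      improve r x best

  -- Returns some k ∈ K(i,j) minimising F[i,k] + F[k,j], with this minimum,
  -- for the pivot p = p(i,j).
  bestSplit : N → N → N → P (opt (pair nat num))
  bestSplit i j p = do
    a ← read₁ rel p
    d ← read₁ dl p
    one ← lit 1
    i+1 ← add i one
    loop i+1 j nothing λ k best → do
      marked ← read₁ mark k
      t ← read₁ τ k
      a≤t ← [ a ] ≤ᵉ t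
      t≤d ← t ≤ᵉ [ d ]
      if marked ∧ a≤t ∧ t≤d then visit k best else ret best
    where
    improve : N → V → T⟦ opt (pair nat num) ⟧ → P (opt (pair nat num))
    improve k x nothing        = ret (just (k , x))
    improve k x (just (l , y)) = do
      smaller ← before x y
      ret (just (if smaller then (k , x) else (l , y)))

    visit : N → T⟦ opt (pair nat num) ⟧ → P (opt (pair nat num))
    visit k best = do
      u ← read F i k
      v ← read F k j
      x ← addⱽ u v
      improve k x best

  fill : N → N → N → P unit
  fill n i j = do
    best ← scan n i j
    fillWith best
    where
    split-at : N → V → T⟦ opt (pair nat num) ⟧ → P unit
    split-at p x nothing        = abort
    split-at p x (just (k , y)) = do
      v ← addⱽ x y
      write F i j v
      write split i j (just k)
      write pivot i j (just p)

    fillWith : T⟦ opt (pair nat num) ⟧ → P unit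
    fillWith nothing = do
      v ← zeroⱽ
      write F i j v
      write split i j nothing
      write pivot i j nothing
    fillWith (just (p , x)) = do
      k⋆ ← bestSplit i j p
      split-at p x k⋆

  -- The body of the recursive procedure Build; its output is the sequence of
  -- services emitted.
  build : N → N → P unit
  build i j = do
    k? ← read split i j
    p? ← read pivot i j
    branch k? p?
    where
    serve : N → T⟦ ext ⟧ → V → P unit
    serve k [ t ] x = do
      call i k
      emit t x
      call k j
    serve k _     x = abort

    branch : T⟦ opt nat ⟧ → T⟦ opt nat ⟧ → P unit
    branch nothing  _        = ret tt
    branch (just k) nothing  = abort
    branch (just k) (just p) = do
      t ← read₁ τ k
      x ← read₁ loc p
      serve k t x

  lad : N → P num
  lad n = do
    z ← lit 0
    one ← lit 1
    two ← lit 2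
    n+2 ← add n two
    alloc₁ τ n+2 ⊥±
    alloc₁ rank n z
    m ← sortDeadlines n
    m+1 ← add m one
    m+2 ← add m two
    zeroᵛ ← zeroⱽ
    alloc₁ mark m+2 false
    alloc F m+2 m+2 zeroᵛ
    alloc split m+2 m+2 nothing
    alloc pivot m+2 m+2 nothing
    for one m+2 λ w → do
      hi ← sub m+2 w
      for z hi λ i → do
        j ← add i w
        fill n i j
    v ← read F z m+1
    call z m+1
    ret v

------------------------------------------------------------------------
-- Executions

module Execution (R : OrderedGroup) where
  open OrderedGroup R using (Carrier)
  open LAD R public
  open Semantics R public

  -- With the choices `choice`, the algorithm terminates on I, returning the
  -- number v in the final state σ.
  _⊢_⇓_,_ : ∀ {n} → (ℕ → Bool) → Instance n → Carrier → State → Set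
  _⊢_⇓_,_ {n} choice I v σ =
    ∃[ fuel ] Run.run choice Algorithm.build fuel (Algorithm.lad n) (initial I)
              ≡ just (v , σ)

{-# OPTIONS --safe #-}
module Submission where

-- For i < j, the cost F[i,j] is the optimum for the requests of I(i,j).  The
-- largest request p = p(i,j) must be covered by some service (t , y).  If τ_k is
-- the first deadline of I(i,j) with t ≤ τ_k, then the services before t cover
-- I(i,k), those after t cover I(k,j), and y ≥ x_p; hence F[i,j] is a lower bound.
-- Conversely, a request of I(i,j) outside I(i,k) ∪ I(k,j) contains τ_k in its
-- window and is covered by (τ_k , x_p).
--
-- Correctness of the program is a matter of weakest preconditions that see only
-- the memory; since time is invisible to them, every way of breaking ties is
-- accounted for.  Running times are bounded separately, from the program text.

open import Defs
open import Algebra.Structures using (IsAbelianGroup)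
open import Data.Bool.Base using (Bool; true; false; _∧_; if_then_else_)
open import Data.Empty using (⊥)
open import Data.Fin.Base using (Fin; toℕ; fromℕ<)
import Data.Fin.Properties as Fin
open import Data.List.Base using (List; []; _∷_; _++_; length; filter; upTo)
import Data.List.Extrema as Extrema
open import Data.List.Membership.Propositional using (_∈_; find; lose)
open import Data.List.Membership.Propositional.Properties
  using (∈-filter⁺; ∈-filter⁻; ∈-upTo⁺; ∈-upTo⁻)
open import Data.List.Properties using (length-++; ++-assoc; ++-identityʳ)
open import Data.List.Relation.Unary.All as All using (All; []; _∷_)
import Data.List.Relation.Unary.All.Properties as All
open import Data.List.Relation.Unary.AllPairs as AllPairs using (AllPairs; []; _∷_)
import Data.List.Relation.Unary.AllPairs.Properties as AllPairs
open import Data.List.Relation.Unary.Any using (here; there; Any)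
import Data.List.Relation.Unary.Any.Properties as Any
open import Data.Maybe.Base using (Maybe; just; nothing)
open import Data.Nat.Base as ℕ using (ℕ; zero; suc; _∸_; z≤n; s≤s; _≡ᵇ_)
import Data.Nat.Properties as ℕ
open import Data.Nat.Solver using (module +-*-Solver)
open import Data.Product.Base using (_×_; _,_; proj₁; proj₂; ∃-syntax; -,_)
open import Data.Sum.Base using (_⊎_; inj₁; inj₂; [_,_]′)
open import Data.Unit.Base using (⊤; tt)
open import Data.Vec.Base using ([]; _∷_)
open import Data.Vec.Relation.Unary.All as Vec using ([]; _∷_)
open import Function.Base using (_∘_; _$_)
open import Level using (0ℓ)
open import Relation.Binary.Bundles using (DecTotalOrder)
import Relation.Binary.Construct.Add.Extrema.Strict as Strict
import Relation.Binary.Construct.NonStrictToStrict as NonStrictToStrict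
open import Relation.Binary.Definitions using (tri<; tri≈; tri>)
import Relation.Binary.Properties.DecTotalOrder as DecTotalOrderProperties
open import Relation.Binary.PropositionalEquality.Core
  using (_≡_; refl; sym; trans; cong; subst; subst₂; _≢_; cong₂)
open import Relation.Binary.PropositionalEquality.Properties using (module ≡-Reasoning)
open import Relation.Binary.Structures using (IsStrictTotalOrder)
open import Relation.Nullary.Construct.Add.Extrema using (_±; ⊥±; [_]; ⊤±)
open import Relation.Nullary.Decidable.Core using (yes; no; decidable-stable; Dec; proof; _×-dec_)
open import Relation.Nullary.Negation.Core using (contradiction; ¬_)
open import Relation.Nullary.Reflects using (Reflects; ofʸ; ofⁿ)

-- Ordered groups and costs

-- An optimal solution may serve `p` at a time `t` that is no deadline, yet the recurrence tries
-- only deadlines in the window of `p`. The first deadline τ_k ≥ t of I(i,j) settles this: a_p ≤ t ≤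
-- τ_k, and τ_k ≤ d_p because the deadline of `p` competes in that minimum. No deadline of I(i,j)
-- lies in [t, τ_k), so the requests of I(i,k) end before `t`; those of I(k,j) start after τ_k ≥ t.
-- The deadline of `p` itself always qualifies as a split, so the program never aborts. The number m
-- of deadlines, hence the size of the tables, is known only after sorting. The preconditions are
-- therefore used twice: in the first phase `τ` and `rank` are written, in the second they count as
-- fixed. The allocations around these phases are executed by computation. Build recurses on table
-- contents and not on program text, so its call tree `Plan` takes the place of the program as the
-- object of induction. Since m ≤ n, the single number n + 2 bounds all loops and table widths.

module Numbers (R : OrderedGroup) where
  open OrderedGroup R
  open LAD R using (Service; cost)

  decTotalOrder : DecTotalOrder 0ℓ 0ℓ 0ℓ
  decTotalOrder = record { isDecTotalOrder = isDecTotalOrder }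

  open DecTotalOrder decTotalOrder public using (_≟_) renaming
    (refl to ≤-refl; reflexive to ≤-reflexive; trans to ≤-trans; antisym to ≤-antisym)
  open DecTotalOrderProperties decTotalOrder public
    using (<-compare; <-isStrictTotalOrder; <⇒≱; ≰⇒>; ≮⇒≥; ≤∧≉⇒<)

  <-≤-trans : ∀ {x y z} → x < y → y ≤ z → x < z
  <-≤-trans = NonStrictToStrict.<-≤-trans _≡_ _≤_ sym ≤-trans ≤-antisym (subst (_ ≤_))

  ≤-<-trans : ∀ {x y z} → x ≤ y → y < z → x < z
  ≤-<-trans = NonStrictToStrict.≤-<-trans _≡_ _≤_ ≤-trans ≤-antisym (subst (_≤ _))

  open Strict _<_ public using (_<±_; [<]-injective)

  open IsStrictTotalOrder (Strict.<±-isStrictTotalOrder-≡ _<_ <-isStrictTotalOrder) public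
    using () renaming (trans to <±-trans; irrefl to <±-irrefl; _<?_ to _<±?_)

  open IsAbelianGroup isAbelianGroup public using ()
    renaming (assoc to +-assoc; comm to +-comm; identityˡ to +-identityˡ)

  ≮⊥± : ∀ {t} → ¬ (t <± ⊥±)
  ≮⊥± {⊥±}    t<⊥ = <±-irrefl refl t<⊥
  ≮⊥± {[ x ]} t<⊥ = <±-irrefl refl (<±-trans t<⊥ Strict.⊥±<[ x ])
  ≮⊥± {⊤±}    ()

  <±-stable : ∀ {s t} → ¬ ¬ (s <± t) → s <± t
  <±-stable {s} {t} = decidable-stable (s <±? t)

  private
    variable
      s t u v : Carrier

  <±-≤-trans : ∀ {i} → i <± [ s ] → s ≤ t → i <± [ t ]
  <±-≤-trans {s} {t} i<s s≤t with s ≟ t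
  ... | yes refl = i<s
  ... | no s≢t   = <±-trans i<s Strict.[ s≤t , s≢t ]

  +-mono-≤ : s ≤ t → u ≤ v → s + u ≤ t + v
  +-mono-≤ {s} {t} {u} {v} s≤t u≤v = ≤-trans (+-monoʳ-≤ s u≤v)
    (subst₂ _≤_ (+-comm v s) (+-comm v t) (+-monoʳ-≤ v s≤t))

  ≤-respˡ-≡ : s ≡ u → s ≤ t → u ≤ t
  ≤-respˡ-≡ {t = t} = subst (_≤ t)

  ≤-+ˡ : 0# ≤ s → t ≤ u → t ≤ s + u
  ≤-+ˡ {t = t} 0≤s t≤u = ≤-respˡ-≡ (+-identityˡ t) (+-mono-≤ 0≤s t≤u)

  +-swapˡ : ∀ s t u → s + (t + u) ≡ t + (s + u)
  +-swapˡ s t u = begin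
    s + (t + u)  ≡⟨ +-assoc s t u ⟨
    (s + t) + u  ≡⟨ cong (_+ u) (+-comm s t) ⟩
    (t + s) + u  ≡⟨ +-assoc t s u ⟩
    t + (s + u)  ∎
    where open ≡-Reasoning

  cost-++ : ∀ S S′ → cost (S ++ S′) ≡ cost S + cost S′
  cost-++ []            S′ = sym (+-identityˡ _)
  cost-++ ((t , y) ∷ S) S′ = trans (cong (y +_) (cost-++ S S′)) (sym (+-assoc y _ _))

  Nonnegative : List Service → Set
  Nonnegative = All (λ s → 0# ≤ proj₂ s)

  cost-nonneg : ∀ {S} → Nonnegative S → 0# ≤ cost S
  cost-nonneg []          = ≤-refl
  cost-nonneg (0≤y ∷ 0≤S) = ≤-+ˡ 0≤y (cost-nonneg 0≤S)

  -- Services at time t itself may be dropped by a cut.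
  record Cut (t v : Carrier) (S : List Service) : Set where
    field
      before after  : List Service
      before-nonneg : Nonnegative before
      after-nonneg  : Nonnegative after
      ∈-before      : ∀ {s} → s ∈ S → proj₁ s < t → s ∈ before
      ∈-after       : ∀ {s} → s ∈ S → t < proj₁ s → s ∈ after
      total-≤       : v + (cost before + cost after) ≤ cost S

  private
    extend : ∀ {t v S} s → 0# ≤ proj₂ s → Cut t v S → Cut t v (s ∷ S)
    extend {t} {v} (u , y) 0≤y C with <-compare u t
    ... | tri< u<t u≢t _ = record
      { before        = (u , y) ∷ before
      ; after         = after
      ; before-nonneg = 0≤y ∷ before-nonneg
      ; after-nonneg  = after-nonneg
      ; ∈-before      = λ { (here refl) _ → here refl ; (there q) <t → there (∈-before q <t) }
      ; ∈-after       = λ { (here refl) t<u → contradiction (proj₁ t<u) (<⇒≱ u<t)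
                          ; (there q) t< → ∈-after q t< }
      ; total-≤       = ≤-respˡ-≡ (trans (+-swapˡ y v _) (cong (v +_) (sym (+-assoc y _ _))))
                          (+-monoʳ-≤ y total-≤)
      } where open Cut C
    ... | tri≈ _ refl _ = record
      { before        = before
      ; after         = after
      ; before-nonneg = before-nonneg
      ; after-nonneg  = after-nonneg
      ; ∈-before      = λ { (here refl) <t → contradiction refl (proj₂ <t)
                          ; (there q) <t → ∈-before q <t }
      ; ∈-after       = λ { (here refl) t< → contradiction refl (proj₂ t<)
                          ; (there q) t< → ∈-after q t< }
      ; total-≤       = ≤-+ˡ 0≤y total-≤
      } where open Cut C
    ... | tri> _ _ t<u = record
      { before        = before
      ; after         = (u , y) ∷ after
      ; before-nonneg = before-nonneg
      ; after-nonneg  = 0≤y ∷ after-nonneg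
      ; ∈-before      = λ { (here refl) u<t → contradiction (proj₁ u<t) (<⇒≱ t<u)
                          ; (there q) <t → ∈-before q <t }
      ; ∈-after       = λ { (here refl) _ → here refl ; (there q) t< → there (∈-after q t<) }
      ; total-≤       = ≤-respˡ-≡ (trans (+-swapˡ y v _) (cong (v +_) (+-swapˡ y _ _)))
                          (+-monoʳ-≤ y total-≤)
      } where open Cut C

    -- No service is singled out here; this treats the services behind the one that `cut` looks for.
    cut₀ : ∀ {t S} → Nonnegative S → Cut t 0# S
    cut₀ [] = record
      { before = [] ; after = [] ; before-nonneg = [] ; after-nonneg = []
      ; ∈-before = λ () ; ∈-after = λ ()
      ; total-≤ = ≤-reflexive (trans (+-identityˡ _) (+-identityˡ _)) }
    cut₀ (0≤y ∷ 0≤S) = extend _ 0≤y (cut₀ 0≤S)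

  -- The service at `t` goes to neither side, which frees its cost `y` to pay for `v`.
  cut : ∀ {t y v S} → Nonnegative S → (t , y) ∈ S → v ≤ y → Cut t v S
  cut (0≤y ∷ 0≤S) (here refl) v≤y = record
    { before        = before
    ; after         = after
    ; before-nonneg = before-nonneg
    ; after-nonneg  = after-nonneg
    ; ∈-before      = λ { (here refl) <t → contradiction refl (proj₂ <t)
                        ; (there q) <t → ∈-before q <t }
    ; ∈-after       = λ { (here refl) t< → contradiction refl (proj₂ t<)
                        ; (there q) t< → ∈-after q t< }
    ; total-≤       = +-mono-≤ v≤y (≤-respˡ-≡ (+-identityˡ _) total-≤)
    } where open Cut (cut₀ 0≤S)
  cut (0≤y ∷ 0≤S) (there s∈S) v≤y = extend _ 0≤y (cut 0≤S s∈S v≤y)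

-- Verifying unit-cost programs

module Logic (R : OrderedGroup) where
  open import Data.Nat.Base using (_≤_; _<_; _+_; _*_; _∸_)
  open Numbers R
  open Semantics R

  Memory : Set
  Memory = (T : Table) → ℕ → ℕ → Value (entryTy T)

  -- The weakest precondition of a program without calls, allocations and
  -- output, for tables with the dimensions `dim` of which only the `mutable`
  -- ones are written; the others have the contents `fixed`.  Time is not part
  -- of the memory, so the outcome of a `flip` is unconstrained.
  module Precondition (dim : Table → ℕ × ℕ) (mutable : Table → Bool) (fixed : Memory) where

    Cell : Table → ℕ → ℕ → Set
    Cell T i j = i < proj₁ (dim T) × j < proj₂ (dim T)

    -- A read of an immutable table reduces to its known contents, so no loop invariant has to carry
    -- the input along.
    contents : Memory → Memory
    contents e T i j = if mutable T then e T i j else fixed T i j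

    wp  : ∀ {t} → Code t → (Value t → Memory → Set) → Memory → Set
    wp* : ∀ {s} → (count k : ℕ) → (ℕ → Value s → Code s) →
          (Value s → Memory → Set) → Value s → Memory → Set

    wp (ret v)             Q e = Q v e
    wp (p >>= f)           Q e = wp p (λ v → wp (f v) Q) e
    wp abort               Q e = ⊥
    wp (loop lo hi s body) Q e = wp* (hi ∸ lo) lo body Q s e
    wp (call i j)          Q e = ⊥
    wp flip                Q e = ∀ b → Q b e
    wp (lit k)             Q e = Q k e
    wp (add i j)           Q e = Q (i + j) e
    wp (sub i j)           Q e = Q (i ∸ j) e
    wp zeroⱽ               Q e = Q (OrderedGroup.0# R) e
    wp (addⱽ x y)          Q e = Q (OrderedGroup._+_ R x y) e
    wp (leqⱽ x y)          Q e = ∀ b → Reflects (OrderedGroup._≤_ R x y) b → Q b e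
    wp (alloc T r c v)     Q e = ⊥
    wp (read T i j)        Q e = Cell T i j × Q (contents e T i j) e
    wp (write T i j v)     Q e = mutable T ≡ true × Cell T i j × Q tt (setEntry T i j v e)
    wp (emit t y)          Q e = ⊥

    wp* zero        k body Q s e = Q s e
    wp* (suc count) k body Q s e = wp (body k s) (wp* count (suc k) body Q) e

    wp-mono  : ∀ {t} (p : Code t) {Q Q′ : Value t → Memory → Set} {e} →
               (∀ {v e} → Q v e → Q′ v e) → wp p Q e → wp p Q′ e
    wp*-mono : ∀ {s} count {k} (body : ℕ → Value s → Code s) {Q Q′ : Value s → Memory → Set} {s e} →
               (∀ {v e} → Q v e → Q′ v e) → wp* count k body Q s e → wp* count k body Q′ s e

    wp-mono (ret v)             Q⇒Q′ q = Q⇒Q′ q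
    wp-mono (p >>= f)           Q⇒Q′ q = wp-mono p (λ {v} → wp-mono (f v) Q⇒Q′) q
    wp-mono (loop lo hi s body) Q⇒Q′ q = wp*-mono (hi ∸ lo) body Q⇒Q′ q
    wp-mono flip                Q⇒Q′ q = Q⇒Q′ ∘ q
    wp-mono (lit k)             Q⇒Q′ q = Q⇒Q′ q
    wp-mono (add i j)           Q⇒Q′ q = Q⇒Q′ q
    wp-mono (sub i j)           Q⇒Q′ q = Q⇒Q′ q
    wp-mono zeroⱽ               Q⇒Q′ q = Q⇒Q′ q
    wp-mono (addⱽ x y)          Q⇒Q′ q = Q⇒Q′ q
    wp-mono (leqⱽ x y)          Q⇒Q′ q b h = Q⇒Q′ (q b h)
    wp-mono (read T i j)        Q⇒Q′ (c , q) = c , Q⇒Q′ q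
    wp-mono (write T i j v)     Q⇒Q′ (m , c , q) = m , c , Q⇒Q′ q

    wp*-mono zero        body Q⇒Q′ q = Q⇒Q′ q
    wp*-mono (suc count) {k} body {s = s} Q⇒Q′ q =
      wp-mono (body k s) (wp*-mono count body Q⇒Q′) q

    private
      wp*-invariant : ∀ {s} count {lo hi} {body : ℕ → Value s → Code s} {Q : Value s → Memory → Set}
        (Inv : ℕ → Value s → Memory → Set) → count + lo ≡ hi →
        (∀ {k s e} → lo ≤ k → k < hi → Inv k s e → wp (body k s) (Inv (suc k)) e) →
        (∀ {s e} → Inv hi s e → Q s e) →
        ∀ {s e} → Inv lo s e → wp* count lo body Q s e
      wp*-invariant zero        Inv refl step done inv = done inv
      wp*-invariant (suc count) {lo} {body = body} Inv refl step done {s} inv =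
        wp-mono (body lo s)
          (wp*-invariant count Inv (ℕ.+-suc count lo) (step ∘ ℕ.<⇒≤) done)
          (step ℕ.≤-refl (s≤s (ℕ.m≤n+m lo count)) inv)

    wp-loop : ∀ {s lo} hi {body : ℕ → Value s → Code s} {Q : Value s → Memory → Set}
      (Inv : ℕ → Value s → Memory → Set) → lo ≤ hi →
      (∀ {k s e} → lo ≤ k → k < hi → Inv k s e → wp (body k s) (Inv (suc k)) e) →
      (∀ {s e} → Inv hi s e → Q s e) →
      ∀ {s e} → Inv lo s e → wp (loop lo hi s body) Q e
    wp-loop {lo = lo} hi Inv lo≤hi = wp*-invariant (hi ∸ lo) Inv (ℕ.m∸n+n≡m lo≤hi)

    wp-if : ∀ {t} b {p q : Code t} {Q : Value t → Memory → Set} {e} →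
      (b ≡ true → wp p Q e) → (b ≡ false → wp q Q e) → wp (if b then p else q) Q e
    wp-if true  p q = p refl
    wp-if false p q = q refl

    open Algorithm

    -- On a tie both inequalities hold, so either outcome of the `flip` is justified. For the same
    -- reason only weak inequalities are promised.
    wp-before : ∀ {x y} {Q : Bool → Memory → Set} {e} →
      (OrderedGroup._≤_ R x y → Q true e) → (OrderedGroup._≤_ R y x → Q false e) →
      wp (before x y) Q e
    wp-before q₁ q₂ _ (ofʸ x≤y) _ (ofʸ y≤x) = λ { true → q₁ x≤y ; false → q₂ y≤x }
    wp-before q₁ q₂ _ (ofʸ x≤y) _ (ofⁿ _)   = q₁ x≤y
    wp-before q₁ q₂ _ (ofⁿ x≰y) _ _         = q₂ (proj₁ (≰⇒> x≰y))

    -- Phrased as a negated strict inequality because `Sorted` and `In` speak of `<±` alone. Since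
    -- `<ᵉ` negates the bit once more, its users obtain a double negation, which `<±-stable`
    -- removes.
    wp-≤ᵉ : ∀ s t {Q : Bool → Memory → Set} {e} →
      (∀ {b} → Reflects (¬ (t <± s)) b → Q b e) → wp (s ≤ᵉ t) Q e
    wp-≤ᵉ ⊥±    ⊥±    q = q (ofʸ ≮⊥±)
    wp-≤ᵉ ⊥±    [ y ] q = q (ofʸ ≮⊥±)
    wp-≤ᵉ ⊥±    ⊤±    q = q (ofʸ λ ())
    wp-≤ᵉ [ x ] ⊥±    q = q (ofⁿ λ ¬t<s → ¬t<s Strict.⊥±<[ x ])
    wp-≤ᵉ [ x ] [ y ] q _ (ofʸ x≤y) = q (ofʸ λ { Strict.[ y<x ] → <⇒≱ y<x x≤y })
    wp-≤ᵉ [ x ] [ y ] q _ (ofⁿ x≰y) = q (ofⁿ λ ¬t<s → ¬t<s Strict.[ ≰⇒> x≰y ])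
    wp-≤ᵉ [ x ] ⊤±    q = q (ofʸ λ ())
    wp-≤ᵉ ⊤±    ⊥±    q = q (ofⁿ λ ¬t<s → ¬t<s Strict.⊥±<⊤±)
    wp-≤ᵉ ⊤±    [ y ] q = q (ofⁿ λ ¬t<s → ¬t<s Strict.[ y ]<⊤±)
    wp-≤ᵉ ⊤±    ⊤±    q = q (ofʸ λ ())

  -- `Within b p`: p makes no calls, allocations or output, and takes at most
  -- b time units in every execution.  The rules add>>= and sub>>= keep the value
  -- computed, on which the number of iterations of a later loop depends.
  data Within : ∀ {t} → ℕ → Code t → Set where
    ret    : ∀ {t b} {v : Value t} → Within b (ret {t = t} v)
    _>>=_  : ∀ {s t b b′} {p : Code s} {f : Value s → Code t} →
             Within b p → (∀ v → Within b′ (f v)) → Within (b + b′) (p >>= f)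
    add>>=_ : ∀ {t b i j} {f : ℕ → Code t} → Within b (f (i + j)) → Within (suc b) (add i j >>= f)
    sub>>=_ : ∀ {t b i j} {f : ℕ → Code t} → Within b (f (i ∸ j)) → Within (suc b) (sub i j >>= f)
    abort  : ∀ {t b} → Within b (abort {t = t})
    loop   : ∀ {s b c lo hi v} {body : ℕ → Value s → Code s} → hi ∸ lo ≤ c →
             (∀ k → k < hi → ∀ s → Within b (body k s)) →
             Within (suc (c * suc b)) (loop lo hi v body)
    flip   : Within 1 flip
    lit    : ∀ {k} → Within 1 (lit k)
    add    : ∀ {i j} → Within 1 (add i j)
    sub    : ∀ {i j} → Within 1 (sub i j)
    zeroⱽ  : Within 1 zeroⱽ
    addⱽ   : ∀ {x y} → Within 1 (addⱽ x y)
    leqⱽ   : ∀ {x y} → Within 1 (leqⱽ x y)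
    read   : ∀ {T i j} → Within 1 (read T i j)
    write  : ∀ {T i j v} → Within 1 (write T i j v)
    slack  : ∀ {t b b′} {p : Code t} → b ≤ b′ → Within b p → Within b′ p

  record Quiet (b : ℕ) (σ σ′ : State) : Set where
    field
      size-≡   : size σ′ ≡ size σ
      output-≡ : output σ′ ≡ output σ
      heap-≡   : heap σ′ ≡ heap σ
      depth-≡  : depth σ′ ≡ depth σ
      space-≡  : space σ′ ≡ space σ
      time-≤   : time σ′ ≤ b + time σ

  open Quiet

  private
    ticks : ∀ {σ} k {b} → k ≤ b → Quiet b σ (tick k σ)
    ticks {σ} k k≤b = record { size-≡ = refl ; output-≡ = refl ; heap-≡ = refl ; depth-≡ = refl
      ; space-≡ = refl ; time-≤ = ℕ.+-monoˡ-≤ (time σ) k≤b }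

    quiet-trans : ∀ {b b′ σ σ′ σ″} → Quiet b σ σ′ → Quiet b′ σ′ σ″ → Quiet (b + b′) σ σ″
    quiet-trans {b} {b′} {σ} h k = record
      { size-≡   = trans (size-≡ k) (size-≡ h)
      ; output-≡ = trans (output-≡ k) (output-≡ h)
      ; heap-≡   = trans (heap-≡ k) (heap-≡ h)
      ; depth-≡  = trans (depth-≡ k) (depth-≡ h)
      ; space-≡  = trans (space-≡ k) (space-≡ h)
      ; time-≤   = ℕ.≤-trans (time-≤ k) (ℕ.≤-trans (ℕ.+-monoʳ-≤ b′ (time-≤ h))
                     (ℕ.≤-reflexive (trans (sym (ℕ.+-assoc b′ b _)) (cong (_+ time σ) (ℕ.+-comm b′ b)))))
      }

  quiet-weaken : ∀ {b b′ σ σ′} → b ≤ b′ → Quiet b σ σ′ → Quiet b′ σ σ′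
  quiet-weaken {σ = σ} b≤b′ h = record
      { size-≡   = size-≡ h
      ; output-≡ = output-≡ h
      ; heap-≡   = heap-≡ h
      ; depth-≡  = depth-≡ h
      ; space-≡  = space-≡ h
      ; time-≤   = ℕ.≤-trans (time-≤ h) (ℕ.+-monoˡ-≤ (time σ) b≤b′)
      }

  -- Executions, and soundness of the preconditions

  module Executions (choice : ℕ → Bool) (proc : ℕ → ℕ → Code unit) where
    open Run choice proc

    -- Unlike `wp`, the postcondition sees the whole final state, so this also handles allocations,
    -- calls and output.
    record Exec {t} (fuel : ℕ) (p : Code t) (σ : State) (Q : Value t → State → Set) : Set where
      constructor exec
      field
        {result} : Value t
        {final}  : State
        run-≡    : run fuel p σ ≡ just (result , final)
        post     : Q result final

    exec-bind : ∀ {fuel s t} {p : Code s} {f : Value s → Code t} {σ} {Q : Value t → State → Set} →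
      Exec fuel p σ (λ v σ′ → Exec fuel (f v) σ′ Q) → Exec fuel (p >>= f) σ Q
    exec-bind {fuel} {p = p} {f} {σ} {Q} (exec {v} {σ′} run-p (exec {w} {σ″} run-f q)) = exec run-both q
      where
      run-both : run fuel (p >>= f) σ ≡ just (w , σ″)
      run-both rewrite run-p = run-f

    exec-mono : ∀ {fuel t} {p : Code t} {σ} {Q Q′ : Value t → State → Set} →
      (∀ {v σ′} → Q v σ′ → Q′ v σ′) → Exec fuel p σ Q → Exec fuel p σ Q′
    exec-mono Q⇒Q′ (exec run-p q) = exec run-p (Q⇒Q′ q)

    exec-read : ∀ {fuel} T {i j σ v} {Q : Value (entryTy T) → State → Set} →
      inBounds σ T i j ≡ true → entry σ T i j ≡ v → Q v (tick 1 σ) → Exec fuel (read T i j) σ Q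
    exec-read {fuel} T {i} {j} {σ} bounds refl q = exec run-read q
      where
      run-read : run fuel (read T i j) σ ≡ just (entry σ T i j , tick 1 σ)
      run-read rewrite bounds = refl

    enter : State → State
    enter σ = record-space (tick 1 (record σ { depth = suc (depth σ) }))

    exec-call : ∀ {fuel i j σ} {Q : ⊤ → State → Set} →
      Exec fuel (proc i j) (enter σ) (λ v σ′ → Q v (record σ′ { depth = depth σ })) →
      Exec (suc fuel) (call i j) σ Q
    exec-call {fuel} {i} {j} {σ} (exec {v} {σ′} run-p q) = exec run-call q
      where
      run-call : run (suc fuel) (call i j) σ ≡ just (v , record σ′ { depth = depth σ })
      run-call rewrite run-p = refl

    module Soundness (dim : Table → ℕ × ℕ) (mutable : Table → Bool) (fixed : Memory) where
      open Precondition dim mutable fixed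

      record Fits (σ : State) : Set where
        field
          bounds : ∀ {T i j} → Cell T i j → inBounds σ T i j ≡ true
          kept   : ∀ {T i j} → Cell T i j → mutable T ≡ false → entry σ T i j ≡ fixed T i j

      open Fits

      private
        contents-entry : ∀ {σ T i j} → Fits σ → Cell T i j → contents (entry σ) T i j ≡ entry σ T i j
        contents-entry {T = T} fit c with mutable T in eq
        ... | true  = refl
        ... | false = sym (kept fit c eq)

        setEntry-≢ : ∀ T {i j v} {e : Memory} T′ {i′ j′} → T ≢ T′ → setEntry T i j v e T′ i′ j′ ≡ e T′ i′ j′
        setEntry-≢ T T′ T≢T′ with sameTable T T′
        ... | just T≡T′ = contradiction T≡T′ T≢T′
        ... | nothing   = refl

      private
        -- `Within` has no rules for calls, allocations and output, so any fuel suffices, and one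
        -- induction on it yields both the outcome promised by `wp` and the resources of the same
        -- run.
        runs : ∀ {t b} {p : Code t} → Within b p → ∀ {fuel σ} {Q : Value t → Memory → Set} →
          Fits σ → wp p Q (entry σ) →
          ∃[ v ] ∃[ σ′ ] (run fuel p σ ≡ just (v , σ′) × Q v (entry σ′) × Fits σ′ × Quiet b σ σ′)

      private
        iterate-wp : ∀ {s b fuel hi} c {k} {body : ℕ → Value s → Code s} →
          (∀ k → k < hi → ∀ v → Within b (body k v)) → ∀ {v σ} {Q : Value s → Memory → Set} →
          c ≤ hi ∸ k → Fits σ → wp* c k body Q v (entry σ) →
          ∃[ v′ ] ∃[ σ′ ] (iterate fuel c k body v σ ≡ just (v′ , σ′) ×
            Q v′ (entry σ′) × Fits σ′ × Quiet (c * suc b) σ σ′)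

        tick-fits : ∀ {σ} → Fits σ → Fits (tick 1 σ)
        tick-fits fit = record { bounds = bounds fit ; kept = kept fit }

        write-fits : ∀ {σ T i j v} → mutable T ≡ true → Fits σ →
          Fits (tick 1 (record σ { entry = setEntry T i j v (entry σ) }))
        write-fits {T = T} T-mutable fit = record
          { bounds = bounds fit
          ; kept   = λ {T′} c T′-fixed → trans
              (setEntry-≢ T T′ λ { refl → contradiction (trans (sym T-mutable) T′-fixed) λ () })
              (kept fit c T′-fixed) }

      runs ret fit q = _ , _ , refl , q , fit , ticks 0 z≤n
      runs (p >>= f) {fuel} {σ} fit q with runs p {fuel} {σ} fit q
      ... | v , σ′ , run-p , q′ , fit′ , quiet with runs (f v) {fuel} {σ′} fit′ q′
      ...   | w , σ″ , run-f , q″ , fit″ , quiet′ rewrite run-p =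
        w , σ″ , run-f , q″ , fit″ , quiet-trans quiet quiet′
      runs (add>>= p) {fuel} {σ} fit q with runs p {fuel} {tick 1 σ} (tick-fits fit) q
      ... | v , σ′ , run-p , q′ , fit′ , quiet =
        v , σ′ , run-p , q′ , fit′ , quiet-trans (ticks 1 ℕ.≤-refl) quiet
      runs (sub>>= p) {fuel} {σ} fit q with runs p {fuel} {tick 1 σ} (tick-fits fit) q
      ... | v , σ′ , run-p , q′ , fit′ , quiet =
        v , σ′ , run-p , q′ , fit′ , quiet-trans (ticks 1 ℕ.≤-refl) quiet
      runs (loop {lo = lo} {hi} h body) {fuel} {σ} fit q
        with iterate-wp {fuel = fuel} (hi ∸ lo) body {σ = tick 1 σ} ℕ.≤-refl (tick-fits fit) q
      ... | v , σ′ , run-p , q′ , fit′ , quiet = v , σ′ , run-p , q′ , fit′ ,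
        quiet-trans (ticks 1 ℕ.≤-refl) (quiet-weaken (ℕ.*-monoˡ-≤ _ h) quiet)
      runs (slack b≤b′ p) {fuel} {σ} fit q with runs p {fuel} {σ} fit q
      ... | v , σ′ , run-p , q′ , fit′ , quiet = v , σ′ , run-p , q′ , fit′ , quiet-weaken b≤b′ quiet
      runs flip  fit q = _ , _ , refl , q _ , tick-fits fit , ticks 1 ℕ.≤-refl
      runs lit   fit q = _ , _ , refl , q , tick-fits fit , ticks 1 ℕ.≤-refl
      runs add   fit q = _ , _ , refl , q , tick-fits fit , ticks 1 ℕ.≤-refl
      runs sub   fit q = _ , _ , refl , q , tick-fits fit , ticks 1 ℕ.≤-refl
      runs zeroⱽ fit q = _ , _ , refl , q , tick-fits fit , ticks 1 ℕ.≤-refl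
      runs addⱽ  fit q = _ , _ , refl , q , tick-fits fit , ticks 1 ℕ.≤-refl
      runs (leqⱽ {x = x} {y}) fit q =
        _ , _ , refl , q _ (proof (OrderedGroup._≤?_ R x y)) , tick-fits fit , ticks 1 ℕ.≤-refl
      runs (read {T = T} {i} {j}) {σ = σ} {Q} fit (c , q) rewrite bounds fit {T} {i} {j} c =
        _ , _ , refl , subst (λ v → Q v (entry σ)) (contents-entry fit c) q , tick-fits fit , ticks 1 ℕ.≤-refl
      runs (write {T = T} {i} {j}) fit (m , c , q) rewrite bounds fit {T} {i} {j} c =
        _ , _ , refl , q , write-fits m fit , record
          { size-≡ = refl ; output-≡ = refl ; heap-≡ = refl ; depth-≡ = refl
          ; space-≡ = refl ; time-≤ = ℕ.≤-refl }

      iterate-wp zero body h fit q = _ , _ , refl , q , fit , ticks 0 z≤n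
      iterate-wp {b = b} {fuel} (suc c) {k} body {v₀} {σ} {Q} h fit q
        -- Here `suc c ≤ hi ∸ k` rules out `hi ∸ k ≡ 0`; hence `k < hi`, as the bound on the loop
        -- body demands.
        with runs (body k (ℕ.m∸n≢0⇒n<m λ eq → ℕ.n≮0 (subst (suc c ≤_) eq h)) v₀)
               {fuel} {tick 1 σ} {wp* c (suc k) _ Q} (tick-fits fit) q
      ... | v , σ′ , run-p , q′ , fit′ , quiet
        with iterate-wp {fuel = fuel} c {suc k} body {σ = σ′}
               (subst (c ≤_) (ℕ.pred[m∸n]≡m∸[1+n] _ k) (ℕ.pred-mono-≤ h)) fit′ q′
      ...   | w , σ″ , run-i , q″ , fit″ , quiet′ rewrite run-p =
        w , σ″ , run-i , q″ , fit″ , quiet-trans (quiet-trans (ticks 1 ℕ.≤-refl) quiet) quiet′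

      exec-wp : ∀ {t b} {p : Code t} → Within b p → ∀ {fuel σ} {Q : Value t → Memory → Set} →
        Fits σ → wp p Q (entry σ) →
        Exec fuel p σ (λ v σ′ → Q v (entry σ′) × Fits σ′ × Quiet b σ σ′)
      exec-wp p fit q with runs p fit q
      ... | _ , _ , run-p , post = exec run-p post

-- The recurrence

module Subproblems (R : OrderedGroup) {n : ℕ} (I : LAD.Instance R n) where
  open OrderedGroup R
  open Numbers R
  open LAD R
  open Semantics R using (column)

  a x d : ℕ → Carrier
  a = column release I
  x = column location I
  d = column deadline I

  -- The program addresses requests by index, while feasibility is stated with `Vec.All`;
  -- `all-columns` and `column-lookup` translate between the two.
  all-columns : ∀ {n} (I : Instance n) (P : Carrier → Carrier → Carrier → Set) →
    (∀ {r} → r ℕ.< n → P (column release I r) (column location I r) (column deadline I r)) →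
    Vec.All (λ q → P (release q) (location q) (deadline q)) I
  all-columns []      P h = []
  all-columns (q ∷ I) P h = h ℕ.z<s ∷ all-columns I P (λ r<n → h (s≤s r<n))

  column-lookup : ∀ {n} {I : Instance n} {P : Carrier → Carrier → Carrier → Set} →
    Vec.All (λ q → P (release q) (location q) (deadline q)) I →
    ∀ {r} → r ℕ.< n → P (column release I r) (column location I r) (column deadline I r)
  column-lookup (p ∷ ps) {zero}  _         = p
  column-lookup {P = P} (p ∷ ps) {suc r} (s≤s r<n) = column-lookup {P = P} ps r<n

  a≤d : ∀ {r} → r ℕ.< n → a r ≤ d r
  a≤d = column-lookup {P = λ a _ d → a ≤ d} (Vec.universal deadline≥release I)

  0≤x : ∀ {r} → r ℕ.< n → 0# ≤ x r
  0≤x = column-lookup {P = λ _ x _ → 0# ≤ x} (Vec.universal (proj₁ ∘ location>0) I)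

  -- Taking three numbers instead of a request makes this an instance of the predicate `P` of
  -- `all-columns` and `column-lookup`.
  CoveredBy : List Service → Carrier → Carrier → Carrier → Set
  CoveredBy S a x d = Any (λ (t , y) → a ≤ t × t ≤ d × x ≤ y) S

  Covered : List Service → ℕ → Set
  Covered S r = CoveredBy S (a r) (x r) (d r)

  record Sorted (m : ℕ) (T : ℕ → Carrier ±) (rank : ℕ → ℕ) : Set where
    field
      m≤n        : m ℕ.≤ n
      first      : T 0 ≡ ⊥±
      last       : T (suc m) ≡ ⊤±
      increasing : ∀ {k} → k ℕ.≤ m → T k <± T (suc k)
      rank≤m     : ∀ {r} → r ℕ.< n → rank r ℕ.≤ m
      T-rank     : ∀ {r} → r ℕ.< n → T (rank r) ≡ [ d r ]

  module WithDeadlines {m T rank} (sorted : Sorted m T rank) where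
    open Sorted sorted

    T-mono : ∀ {i j} → i ℕ.< j → j ℕ.≤ suc m → T i <± T j
    T-mono {i} i<j j≤m+1 with ℕ.≤⇒≤′ i<j
    ... | ℕ.≤′-refl         = increasing (ℕ.s≤s⁻¹ j≤m+1)
    ... | ℕ.≤′-step {j} i<j′ =
      <±-trans (T-mono (ℕ.≤′⇒≤ i<j′) (ℕ.≤-trans (ℕ.n≤1+n j) j≤m+1)) (increasing (ℕ.s≤s⁻¹ j≤m+1))

    T-cancel : ∀ {i j} → i ℕ.≤ suc m → T i <± T j → i ℕ.< j
    T-cancel {i} {j} i≤m+1 Ti<Tj with ℕ.<-cmp i j
    ... | tri< i<j _ _  = i<j
    ... | tri≈ _ refl _ = contradiction Ti<Tj (<±-irrefl refl)
    ... | tri> _ _ j<i  = contradiction (<±-trans Ti<Tj (T-mono j<i i≤m+1)) (<±-irrefl refl)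

    -- Membership of the request r in I(i,j).
    In : ℕ → ℕ → ℕ → Set
    In i j r = T i <± [ a r ] × [ d r ] <± T j

    in? : ∀ i j r → Dec (In i j r)
    in? i j r = T i <±? [ a r ] ×-dec [ d r ] <±? T j

    Empty : ℕ → ℕ → Set
    Empty i j = ∀ {r} → r ℕ.< n → ¬ In i j r

    -- Ranging over all lists with nonnegative locations, and not only over solutions, admits both
    -- sides of a `Cut` without further proof.
    LowerBound : ℕ → ℕ → Carrier → Set
    LowerBound i j v = ∀ {S} → Nonnegative S →
      (∀ {r} → r ℕ.< n → In i j r → Covered S r) → v ≤ cost S

    -- Membership of `k` in K(i,j). The condition d_r = τ_k appears as `rank r ≡ k`, the form in
    -- which `mark` records it.
    record Candidate (i j p k : ℕ) : Set where
      field
        {t} : Carrier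
        {r} : ℕ
        i<k : i ℕ.< k
        k<j : k ℕ.< j
        Tk≡t : T k ≡ [ t ]
        a≤t : a p ≤ t
        t≤d : t ≤ d p
        r<n : r ℕ.< n
        r∈I : In i j r
        rank-r : rank r ≡ k

    private
      module DTO = Extrema (DecTotalOrder.totalOrder decTotalOrder)

    -- Let (t , y) be a service covering the pivot p, and let k be the rank of
    -- the first deadline of I(i,j) that is at least t.  The services before t
    -- cover I(i,k) and those after t cover I(k,j).
    lowerBound-pivot : ∀ {i j p y} → i ℕ.≤ suc m → j ℕ.≤ suc m → p ℕ.< n → In i j p →
      (∀ {k} → Candidate i j p k →
        ∃[ u ] ∃[ v ] (LowerBound i k u × LowerBound k j v × y ≤ u + v)) →
      LowerBound i j (x p + y)
    lowerBound-pivot {i} {j} {p} {y} i≤m+1 j≤m+1 p<n p∈I@(Ti<a , d<Tj) bounds {S} 0≤S covered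
      with find (covered p<n p∈I)
    ... | (t , _) , s∈S , a≤t , t≤d , x≤y = bound
      where
      late? : ∀ r → Dec (In i j r × t ≤ d r)
      late? r = in? i j r ×-dec t ≤? d r

      late : List ℕ
      late = filter late? (upTo n)

      r : ℕ
      -- The default `p` is harmless: it is late itself, since `t ≤ d p`.
      r = DTO.argmin d p late

      r-late : r ℕ.< n × In i j r × t ≤ d r
      r-late = DTO.argmin-all d (p<n , p∈I , t≤d)
        (All.tabulate λ q → let q∈ , l = ∈-filter⁻ late? q in ∈-upTo⁻ q∈ , l)

      r<n = proj₁ r-late
      t≤dr = proj₂ (proj₂ r-late)

      minimal : ∀ {q} → q ℕ.< n → In i j q × t ≤ d q → d r ≤ d q
      minimal q<n l = All.lookup (DTO.f[argmin]≤f[xs] p late) (∈-filter⁺ late? (∈-upTo⁺ q<n) l)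

      k : ℕ
      k = rank r

      k≤m+1 : k ℕ.≤ suc m
      k≤m+1 = ℕ.m≤n⇒m≤1+n (rank≤m r<n)

      i<k : i ℕ.< k
      i<k = T-cancel i≤m+1 (subst (T i <±_) (sym (T-rank r<n))
        (<±-≤-trans (proj₁ (proj₁ (proj₂ r-late))) (a≤d r<n)))

      k<j : k ℕ.< j
      k<j = T-cancel k≤m+1 (subst (_<± T j) (sym (T-rank r<n)) (proj₂ (proj₁ (proj₂ r-late))))

      candidate : Candidate i j p k
      candidate = record
        { i<k = i<k ; k<j = k<j ; Tk≡t = T-rank r<n
        -- The window of `p` contains `d r`: it is at least `t ≥ a p`, and at most `d p` because `p`
        -- is late.
        ; a≤t = ≤-trans a≤t t≤dr ; t≤d = minimal p<n (p∈I , t≤d)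
        ; r<n = r<n ; r∈I = proj₁ (proj₂ r-late) ; rank-r = refl }

      C : Cut t (x p) S
      C = cut 0≤S s∈S x≤y
      open Cut C

      left : ∀ {q} → q ℕ.< n → In i k q → Covered before q
      left {q} q<n (Ti<a , d<Tk) with find (covered q<n q∈I)
        where
        q∈I : In i j q
        q∈I = Ti<a , <±-trans d<Tk (T-mono k<j j≤m+1)
      ... | s , s∈S , c@(_ , s≤d , _) = lose (∈-before s∈S (≤-<-trans s≤d d<t)) c
        where
        d<dr : d q < d r
        d<dr = [<]-injective (subst ([ d q ] <±_) (T-rank r<n) d<Tk)
        d<t : d q < t
        -- Otherwise `q` would be late with a deadline below the minimum.
        d<t = ≰⇒> λ t≤dq → <⇒≱ d<dr (minimal q<n ((Ti<a , <±-trans d<Tk (T-mono k<j j≤m+1)) , t≤dq))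

      right : ∀ {q} → q ℕ.< n → In k j q → Covered after q
      right {q} q<n (Tk<a , d<Tj) with find (covered q<n (<±-trans (T-mono i<k k≤m+1) Tk<a , d<Tj))
      ... | s , s∈S , c@(a≤s , _) = lose (∈-after s∈S (<-≤-trans t<a a≤s)) c
        where
        t<a : t < a q
        t<a = ≤-<-trans t≤dr ([<]-injective (subst (_<± [ a q ]) (T-rank r<n) Tk<a))

      bound : x p + y ≤ cost S
      bound with bounds candidate
      ... | u , v , lower-u , lower-v , y≤u+v = ≤-trans
        (+-monoʳ-≤ (x p) (≤-trans y≤u+v (+-mono-≤ (lower-u before-nonneg left) (lower-v after-nonneg right))))
        total-≤

    -- What the chosen split must satisfy for feasibility; `Candidate` describes the splits over
    -- which the minimum must range for optimality.
    record Serves (i j k p : ℕ) (t : Carrier) : Set where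
      field
        i<k     : i ℕ.< k
        k<j     : k ℕ.< j
        Tk≡t    : T k ≡ [ t ]
        p<n     : p ℕ.< n
        a≤t     : a p ≤ t
        t≤d     : t ≤ d p
        maximum : ∀ {r} → r ℕ.< n → In i j r → x r ≤ x p

    -- Reading a solution off the tables

    module Tables (φ : ℕ → ℕ → Carrier) (κ π : ℕ → ℕ → Maybe ℕ) where

      -- A local statement: apart from its own cell it mentions only (i,k) and (k,j), so it survives
      -- every write that leaves these cells alone.
      data Solved (i j : ℕ) : Set where
        empty : κ i j ≡ nothing → Empty i j → φ i j ≡ 0# → Solved i j
        serve : ∀ {k p t} → κ i j ≡ just k → π i j ≡ just p → Serves i j k p t →
                φ i j ≡ x p + (φ i k + φ k j) → LowerBound i j (φ i j) → Solved i j

      lowerBound : ∀ {i j} → Solved i j → LowerBound i j (φ i j)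
      lowerBound (empty _ _ φ≡0)      0≤S _ = ≤-respˡ-≡ (sym φ≡0) (cost-nonneg 0≤S)
      lowerBound (serve _ _ _ _ lower) = lower

      -- The finite call tree of Build on the tables, indexed by the services in the order of
      -- emission. The properties of the output and the execution of Build are proved by induction
      -- on it.
      data Plan : ℕ → ℕ → List Service → Set where
        empty : ∀ {i j} → κ i j ≡ nothing → Empty i j → φ i j ≡ 0# → Plan i j []
        serve : ∀ {i j k p t L M} → κ i j ≡ just k → π i j ≡ just p → Serves i j k p t →
                φ i j ≡ x p + (φ i k + φ k j) → Plan i k L → Plan k j M →
                Plan i j (L ++ (t , x p) ∷ M)

      plan : (∀ {i j} → i ℕ.< j → j ℕ.≤ suc m → Solved i j) →
             ∀ {i j} → i ℕ.< j → j ℕ.≤ suc m → ∃[ L ] Plan i j L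
      -- The counter `w` bounds the width of the interval, which a split strictly decreases; `j` is
      -- a sufficient start because j ≤ i + j.
      plan solved {i} {j} i<j = go j (ℕ.m≤n+m j i) i<j
        where
        go : ∀ w {i j} → j ℕ.≤ i ℕ.+ w → i ℕ.< j → j ℕ.≤ suc m → ∃[ L ] Plan i j L
        go zero    {i} j≤i+w i<j _ = contradiction (subst (_ ℕ.≤_) (ℕ.+-identityʳ i) j≤i+w) (ℕ.<⇒≱ i<j)
        go (suc w) {i} {j} j≤i+w i<j j≤m+1 with solved i<j j≤m+1
        ... | empty κ≡ none φ≡0          = -, empty κ≡ none φ≡0
        ... | serve κ≡ π≡ served φ≡ _ = -, serve κ≡ π≡ served φ≡
            (proj₂ (go w (ℕ.s≤s⁻¹ (ℕ.≤-trans k<j j≤)) i<k (ℕ.≤-trans (ℕ.<⇒≤ k<j) j≤m+1)))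
            (proj₂ (go w (ℕ.≤-trans j≤ (ℕ.+-monoˡ-≤ w i<k)) k<j j≤m+1))
          where
          open Serves served
          j≤ : j ℕ.≤ suc (i ℕ.+ w)
          j≤ = subst (j ℕ.≤_) (ℕ.+-suc i w) j≤i+w

      plan-cost : ∀ {i j L} → Plan i j L → cost L ≡ φ i j
      plan-cost (empty _ _ φ≡0) = sym φ≡0
      plan-cost (serve {L = L} _ _ _ φ≡ left right) =
        trans (cost-++ L _) (trans (+-swapˡ _ _ _)
          (trans (cong (x _ +_) (cong₂ _+_ (plan-cost left) (plan-cost right))) (sym φ≡)))

      plan-nonneg : ∀ {i j L} → Plan i j L → Nonnegative L
      plan-nonneg (empty _ _ _) = []
      plan-nonneg (serve _ _ served _ left right) =
        All.++⁺ (plan-nonneg left) (0≤x (Serves.p<n served) ∷ plan-nonneg right)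

      Between : ℕ → ℕ → Service → Set
      Between i j (t , _) = T i <± [ t ] × [ t ] <± T j

      plan-between : ∀ {i j L} → j ℕ.≤ suc m → Plan i j L → All (Between i j) L
      plan-between _     (empty _ _ _) = []
      plan-between {i} {j} j≤m+1 (serve {k = k} {t = t} _ _ served _ left right) = All.++⁺
        (All.map (λ (i<s , s<k) → i<s , <±-trans s<k Tk<Tj) (plan-between k≤m+1 left))
        ((subst (T i <±_) Tk≡t Ti<Tk , subst (_<± T j) Tk≡t Tk<Tj) ∷
         All.map (λ (k<s , s<j) → <±-trans Ti<Tk k<s , s<j) (plan-between j≤m+1 right))
        where
        open Serves served
        k≤m+1 = ℕ.≤-trans (ℕ.<⇒≤ k<j) j≤m+1
        Ti<Tk = T-mono i<k k≤m+1
        Tk<Tj = T-mono k<j j≤m+1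

      -- The left part lies before τ_k and the right part after it. Strictly increasing times make
      -- the services distinct.
      plan-ordered : ∀ {i j L} → j ℕ.≤ suc m → Plan i j L → AllPairs (λ s s′ → proj₁ s < proj₁ s′) L
      plan-ordered _ (empty _ _ _) = []
      plan-ordered {i} {j} j≤m+1 (serve {k = k} {t = t} _ _ served _ left right) = AllPairs.++⁺
        (plan-ordered k≤m+1 left)
        (All.map (λ { (k<s , _) → [<]-injective (subst (_<± _) Tk≡t k<s) }) (plan-between j≤m+1 right)
          ∷ plan-ordered j≤m+1 right)
        (All.map (λ { (_ , s<k) → [<]-injective (subst (_ <±_) Tk≡t s<k)
                      ∷ All.map (λ (k<s′ , _) → [<]-injective (<±-trans s<k k<s′)) (plan-between j≤m+1 right) })
          (plan-between k≤m+1 left))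
        where
        open Serves served
        k≤m+1 = ℕ.≤-trans (ℕ.<⇒≤ k<j) j≤m+1

      plan-covers : ∀ {i j L} → Plan i j L → ∀ {r} → r ℕ.< n → In i j r → Covered L r
      plan-covers (empty _ none _) r<n r∈I = contradiction r∈I (none r<n)
      plan-covers (serve {t = t} {L = L} _ _ served _ left right) {r} r<n r∈I@(Ti<a , d<Tj)
        with t ≤? d r | a r ≤? t
      ... | no t≰d  | _ = Any.++⁺ˡ (plan-covers left r<n (Ti<a ,
              subst ([ d r ] <±_) (sym (Serves.Tk≡t served)) Strict.[ ≰⇒> t≰d ]))
      ... | yes t≤d | no a≰t = Any.++⁺ʳ L (there (plan-covers right r<n
              (subst (_<± [ a r ]) (sym (Serves.Tk≡t served)) Strict.[ ≰⇒> a≰t ] , d<Tj)))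
      ... | yes t≤d | yes a≤t = Any.++⁺ʳ L (here (a≤t , t≤d , Serves.maximum served r<n r∈I))

      -- The splits are distinct indices strictly between `i` and `j`. On the whole interval this
      -- leaves at most m services, which bounds the output, the time and the recursion depth of
      -- Build.
      plan-length : ∀ {i j L} → i ℕ.< j → Plan i j L → length L ℕ.+ i ℕ.< j
      plan-length i<j (empty _ _ _) = i<j
      plan-length {i} {j} i<j (serve {k = k} {t = t} {L = L} {M} _ _ served _ left right) = begin-strict
        length (L ++ _ ∷ M) ℕ.+ i           ≡⟨ cong (ℕ._+ i) (trans (length-++ L) (ℕ.+-comm (length L) _)) ⟩
        suc (length M ℕ.+ length L) ℕ.+ i   ≡⟨ cong suc (ℕ.+-assoc (length M) (length L) i) ⟩
        suc (length M ℕ.+ (length L ℕ.+ i)) ≡⟨ ℕ.+-suc (length M) _ ⟨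
        length M ℕ.+ suc (length L ℕ.+ i)   ≤⟨ ℕ.+-monoʳ-≤ (length M) (plan-length (Serves.i<k served) left) ⟩
        length M ℕ.+ k                      <⟨ plan-length (Serves.k<j served) right ⟩
        j                                   ∎
        where open ℕ.≤-Reasoning

-- Sorting the deadlines

-- The width `w` is 0 during sorting, before the dynamic tables exist, and m + 2 afterwards. The
-- table `τ` is allocated before m is known, hence with n + 2 columns.
layout : ℕ → ℕ → Table → ℕ × ℕ
layout n w rel   = 1 , n
layout n w loc   = 1 , n
layout n w dl    = 1 , n
layout n w τ     = 1 , n ℕ.+ 2
layout n w rank  = 1 , n
layout n w mark  = 1 , w
layout n w F     = w , w
layout n w split = w , w
layout n w pivot = w , w

below-suc : ∀ {k} {P : ℕ → Set} → (∀ {r} → r ℕ.< k → P r) → P k → ∀ {r} → r ℕ.< suc k → P r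
below-suc below at r<1+k with ℕ.m≤n⇒m<n∨m≡n (ℕ.s≤s⁻¹ r<1+k)
... | inj₁ r<k  = below r<k
... | inj₂ refl = at

module _ {A : Set} {v w : A} where

  updated : ∀ i j → (if (i ≡ᵇ i) ∧ (j ≡ᵇ j) then v else w) ≡ v
  updated zero    zero    = refl
  updated zero    (suc j) = updated zero j
  updated (suc i) j       = updated i j

  not-updated : ∀ {i j i′ j′} → i ≢ i′ ⊎ j ≢ j′ → (if (i ≡ᵇ i′) ∧ (j ≡ᵇ j′) then v else w) ≡ w
  not-updated {i} {j} {i′} {j′} different
    with i ≡ᵇ i′ | ℕ.≡ᵇ⇒≡ i i′ | j ≡ᵇ j′ | ℕ.≡ᵇ⇒≡ j j′ | different
  ... | false | _    | _     | _    | _         = refl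
  ... | true  | _    | false | _    | _         = refl
  ... | true  | i≡i′ | true  | j≡j′ | inj₁ i≢i′ = contradiction (i≡i′ _) i≢i′
  ... | true  | i≡i′ | true  | j≡j′ | inj₂ j≢j′ = contradiction (j≡j′ _) j≢j′

module Sorting (R : OrderedGroup) {n : ℕ} (I : LAD.Instance R n) where
  open OrderedGroup R
  open Numbers R
  open Semantics R hiding (size; entry; output; time; heap; depth; space)
  open Logic R
  open Subproblems R I

  inputs : Memory
  inputs rel   _ = a
  inputs loc   _ = x
  inputs dl    _ = d
  inputs τ     _ _ = ⊥±
  inputs rank  _ _ = 0
  inputs mark  _ _ = false
  inputs F     _ _ = 0#
  inputs split _ _ = nothing
  inputs pivot _ _ = nothing

  sorted-tables : Table → Bool
  sorted-tables τ    = true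
  sorted-tables rank = true
  sorted-tables _    = false

  open Precondition (layout n 0) sorted-tables inputs

  -- Here and in `Pivot`, `k` counts the requests inspected so far; in `Best` the indices below `k`
  -- have been tried.
  data Next (t : Carrier ±) (k : ℕ) : Maybe Carrier → Set where
    none  : (∀ {r} → r ℕ.< k → ¬ (t <± [ d r ])) → Next t k nothing
    some  : ∀ {r} → r ℕ.< n → t <± [ d r ] → (∀ {q} → q ℕ.< k → t <± [ d q ] → d r ≤ d q) →
            Next t k (just (d r))

  wp-nextDeadline : ∀ t {Q : Maybe Carrier → Memory → Set} {e} →
    (∀ {v} → Next t n v → Q v e) → wp (Algorithm.nextDeadline n t) Q e
  wp-nextDeadline t {e = e} q = wp-loop n (λ k v e′ → e′ ≡ e × Next t k v) z≤n
    (λ { {k} _ k<n (refl , none ∀≮) → (ℕ.z<s , k<n) , wp-≤ᵉ [ d k ] t λ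
           { (ofʸ t≮d)  → refl , none (below-suc ∀≮ t≮d)
           ; (ofⁿ ¬t≮d) → refl , some k<n (<±-stable ¬t≮d)
               (below-suc {P = λ q → t <± [ d q ] → d k ≤ d q}
                 (λ r<k t<d → contradiction t<d (∀≮ r<k)) (λ _ → ≤-refl)) }
       ; {k} _ k<n (refl , some r<n t<dr least) → (ℕ.z<s , k<n) , wp-≤ᵉ [ d k ] t λ
           { (ofʸ t≮d)  → refl , some r<n t<dr (below-suc least (λ t<d → contradiction t<d t≮d))
           ; (ofⁿ ¬t≮d) → λ
               { _ (ofʸ dr≤dk) → refl , some r<n t<dr (below-suc least (λ _ → dr≤dk))
               ; _ (ofⁿ dr≰dk) → refl , some k<n (<±-stable ¬t≮d)
                   (below-suc (λ q<k t<d → ≤-trans (proj₁ (≰⇒> dr≰dk)) (least q<k t<d)) (λ _ → ≤-refl)) } } })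
    (λ { (refl , next) → q next }) (refl , none λ ())

  record Ranked (k : ℕ) (t : Carrier) (c : ℕ) (e e′ : Memory) : Set where
    field
      τ-kept : e′ τ ≡ e τ
      hit    : ∀ {r} → r ℕ.< c → d r ≡ t → e′ rank 0 r ≡ k
      miss   : ∀ {r} → d r ≢ t → e′ rank 0 r ≡ e rank 0 r

  wp-setRanks : ∀ k t {Q : _ → Memory → Set} {e} →
    (∀ {e′} → Ranked k t n e e′ → Q tt e′) → wp (Algorithm.setRanks n k t) Q e
  wp-setRanks k t {e = e} q = wp-loop n (λ c _ e′ → Ranked k t c e e′) z≤n
    (λ { _ c<n ranked → (ℕ.z<s , c<n) , λ
         { _ (ofʸ d≤t) _ (ofʸ t≤d) → refl , (ℕ.z<s , c<n) , ranked-write (≤-antisym d≤t t≤d) ranked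
         ; _ (ofʸ d≤t) _ (ofⁿ t≰d) → ranked-skip (λ d≡t → t≰d (≤-reflexive (sym d≡t))) ranked
         ; _ (ofⁿ d≰t) _ _         → ranked-skip (λ d≡t → d≰t (≤-reflexive d≡t)) ranked } })
    q record { τ-kept = refl ; hit = λ () ; miss = λ _ → refl }
    where
    ranked-skip : ∀ {c e′} → d c ≢ t → Ranked k t c e e′ → Ranked k t (suc c) e e′
    ranked-skip d≢t ranked = record
      { τ-kept = τ-kept ; hit = below-suc hit (λ d≡t → contradiction d≡t d≢t) ; miss = miss }
      where open Ranked ranked

    ranked-write : ∀ {c e′} → d c ≡ t → Ranked k t c e e′ →
                   Ranked k t (suc c) e (setEntry rank 0 c k e′)
    ranked-write {c} {e′} dc≡t ranked = record
      { τ-kept = τ-kept ; hit = hit′ _ ; miss = λ {r} dr≢t →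
          trans (not-updated {i = 0} {c} {0} {r} (inj₂ λ { refl → dr≢t dc≡t })) (miss dr≢t) }
      where
      open Ranked ranked
      hit′ : ∀ r → r ℕ.< suc c → d r ≡ t → setEntry rank 0 c k e′ rank 0 r ≡ k
      hit′ r r<1+c dr≡t with c ℕ.≟ r
      ... | yes refl = updated 0 c
      ... | no c≢r   = trans (not-updated {i = 0} {c} {0} {r} (inj₂ c≢r))
              (hit (ℕ.≤∧≢⇒< (ℕ.s≤s⁻¹ r<1+c) (c≢r ∘ sym)) dr≡t)

  -- The state of the sorting loop after c rounds.
  record Prefix (c m : ℕ) (T : ℕ → Carrier ±) (rk : ℕ → ℕ) : Set where
    field
      m≤c        : m ℕ.≤ c
      first      : T 0 ≡ ⊥±
      increasing : ∀ {k} → k ℕ.< m → T k <± T (suc k)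
      attained   : ∀ {k} → k ℕ.< m → ∃[ r ] (r ℕ.< n × T (suc k) ≡ [ d r ])
      ranked     : ∀ {r} → r ℕ.< n → ¬ (T m <± [ d r ]) → rk r ℕ.≤ m × T (rk r) ≡ [ d r ]
      -- The loop has `n` rounds and no early exit: either every round found a new deadline, or none
      -- is left and further rounds are idle.
      progress   : m ≡ c ⊎ (∀ {r} → r ℕ.< n → ¬ (T m <± [ d r ]))

    T-mono : ∀ {i j} → i ℕ.< j → j ℕ.≤ m → T i <± T j
    T-mono i<j j≤m with ℕ.≤⇒≤′ i<j
    ... | ℕ.≤′-refl      = increasing j≤m
    ... | ℕ.≤′-step i<j′ = <±-trans (T-mono (ℕ.≤′⇒≤ i<j′) (ℕ.<⇒≤ j≤m)) (increasing j≤m)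

  prefix-⊥ : ∀ {T rk} → T 0 ≡ ⊥± → Prefix 0 0 T rk
  prefix-⊥ T0≡⊥ = record
    { m≤c = z≤n ; first = T0≡⊥ ; increasing = λ () ; attained = λ ()
    ; ranked = λ _ T0≮d → contradiction (subst (_<± _) (sym T0≡⊥) Strict.⊥±<[ _ ]) T0≮d
    ; progress = inj₁ refl }

  prefix-idle : ∀ {c m T rk} → Prefix c m T rk → Next (T m) n nothing → Prefix (suc c) m T rk
  prefix-idle prefix (none done) = record
    { m≤c = ℕ.m≤n⇒m≤1+n m≤c ; first = first ; increasing = increasing ; attained = attained
    ; ranked = ranked ; progress = inj₂ done }
    where open Prefix prefix

  prefix-extend : ∀ {c m t T T′ rk rk′} → Prefix c m T rk → Next (T m) n (just t) →
    T′ (suc m) ≡ [ t ] → (∀ {k} → k ℕ.≤ m → T′ k ≡ T k) →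
    (∀ {r} → r ℕ.< n → d r ≡ t → rk′ r ≡ suc m) → (∀ {r} → d r ≢ t → rk′ r ≡ rk r) →
    Prefix (suc c) (suc m) T′ rk′
  prefix-extend {c} {m} {t} {T} {T′} {rk} {rk′} prefix (some {q} q<n Tm<t least) new old hit miss = record
    { m≤c        = s≤s m≤c
    ; first      = trans (old z≤n) first
    ; increasing = λ k<1+m → increasing′ (ℕ.m≤n⇒m<n∨m≡n (ℕ.s≤s⁻¹ k<1+m))
    ; attained   = λ k<1+m → attained′ (ℕ.m≤n⇒m<n∨m≡n (ℕ.s≤s⁻¹ k<1+m))
    ; ranked     = ranked′
    ; progress   = inj₁ (cong suc ([ (λ m≡c → m≡c) , (λ done → contradiction Tm<t (done q<n)) ]′ progress))
    }
    where
    open Prefix prefix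

    increasing′ : ∀ {k} → k ℕ.< m ⊎ k ≡ m → T′ k <± T′ (suc k)
    increasing′ (inj₁ k<m)  = subst₂ _<±_ (sym (old (ℕ.<⇒≤ k<m))) (sym (old k<m)) (increasing k<m)
    increasing′ (inj₂ refl) = subst₂ _<±_ (sym (old ℕ.≤-refl)) (sym new) Tm<t

    attained′ : ∀ {k} → k ℕ.< m ⊎ k ≡ m → ∃[ r ] (r ℕ.< n × T′ (suc k) ≡ [ d r ])
    attained′ (inj₁ k<m) = let r , r<n , eq = attained k<m in r , r<n , trans (old k<m) eq
    attained′ (inj₂ refl) = q , q<n , new

    ranked′ : ∀ {r} → r ℕ.< n → ¬ (T′ (suc m) <± [ d r ]) → rk′ r ℕ.≤ suc m × T′ (rk′ r) ≡ [ d r ]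
    ranked′ {r} r<n ≮d with d r ≟ t
    ... | yes d≡t = ℕ.≤-reflexive (hit r<n d≡t) ,
            trans (cong T′ (hit r<n d≡t)) (trans new (cong [_] (sym d≡t)))
    -- If `d r` exceeded τ_m, leastness would give t ≤ d r, hence t < d r, which is excluded; so `r`
    -- was ranked in an earlier round.
    ... | no d≢t with ranked r<n (λ Tm<d → ≮d (subst (_<± [ d r ]) (sym new)
                        Strict.[ ≤∧≉⇒< (least r<n Tm<d) (d≢t ∘ sym) ]))
    ...   | rk≤m , T-rk = ℕ.m≤n⇒m≤1+n (subst (ℕ._≤ m) (sym (miss d≢t)) rk≤m) ,
            trans (cong T′ (miss d≢t)) (trans (old rk≤m) T-rk)

  -- If m = n and some deadline exceeds τ_m, then pick for each k ≤ m a request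
  -- whose deadline is the first after τ_k; two of these n + 1 requests agree.
  prefix-exhausted : ∀ {m T rk} → Prefix n m T rk → ∀ {r} → r ℕ.< n → ¬ (T m <± [ d r ])
  prefix-exhausted {m} {T} prefix {q} q<n Tm<d with Prefix.progress prefix
  ... | inj₂ done = done q<n Tm<d
  ... | inj₁ refl = collision (Fin.pigeonhole ℕ.≤-refl λ i → fromℕ< (proj₁ (proj₂ (request i))))
    where
    open Prefix prefix

    next : ∀ {k} → k ℕ.≤ n → ∃[ r ] (r ℕ.< n × T k <± [ d r ] ×
             (∀ {k′} → k ℕ.< k′ → k′ ℕ.≤ n → ¬ (T k′ <± [ d r ])))
    next {k} k≤n with ℕ.m≤n⇒m<n∨m≡n k≤n
    ... | inj₂ refl = q , q<n , Tm<d , λ k<k′ k′≤n → contradiction k′≤n (ℕ.<⇒≱ k<k′)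
    ... | inj₁ k<n with attained k<n
    ...   | r , r<n , eq = r , r<n , subst (T k <±_) eq (increasing k<n) , above
      where
      above : ∀ {k′} → k ℕ.< k′ → k′ ℕ.≤ n → ¬ (T k′ <± [ d r ])
      above k<k′ k′≤n Tk′<d with ℕ.m≤n⇒m<n∨m≡n k<k′
      ... | inj₁ 1+k<k′ = <±-irrefl refl
              (<±-trans (subst (T _ <±_) (sym eq) Tk′<d) (T-mono 1+k<k′ k′≤n))
      ... | inj₂ refl   = <±-irrefl eq Tk′<d

    request : ∀ (i : Fin (suc n)) → ∃[ r ] (r ℕ.< n × T (toℕ i) <± [ d r ] ×
                (∀ {k′} → toℕ i ℕ.< k′ → k′ ℕ.≤ n → ¬ (T k′ <± [ d r ])))
    request i = next (ℕ.s≤s⁻¹ (Fin.toℕ<n i))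

    collision : ¬ (∃[ i ] ∃[ j ] (toℕ i ℕ.< toℕ j ×
      fromℕ< (proj₁ (proj₂ (request i))) ≡ fromℕ< (proj₁ (proj₂ (request j)))))
    collision (i , j , i<j , same) with request i | request j
    ... | r , r<n , _ , above | r′ , r′<n , Tj<d , _ =
      -- The deadline chosen for `i` is not above τ_j, while the one chosen for `j` is.
      above i<j (ℕ.s≤s⁻¹ (Fin.toℕ<n j))
        (subst (λ r → T (toℕ j) <± [ d r ]) (sym (Fin.fromℕ<-injective r r′ r<n r′<n same)) Tj<d)

  prefix-sorted : ∀ {m T T′ rk} → Prefix n m T rk →
    T′ (suc m) ≡ ⊤± → (∀ {k} → k ℕ.≤ m → T′ k ≡ T k) → Sorted m T′ rk
  prefix-sorted {m} {T} {T′} prefix new old = record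
    { m≤n        = m≤c
    ; first      = trans (old z≤n) first
    ; last       = new
    ; increasing = λ k≤m → increasing′ (ℕ.m≤n⇒m<n∨m≡n k≤m)
    ; rank≤m     = λ r<n → proj₁ (all-ranked r<n)
    ; T-rank     = λ r<n → trans (old (proj₁ (all-ranked r<n))) (proj₂ (all-ranked r<n))
    }
    where
    open Prefix prefix

    all-ranked : ∀ {r} → r ℕ.< n → _
    all-ranked r<n = ranked r<n (prefix-exhausted prefix r<n)

    T<⊤ : ∀ {k} → k ℕ.≤ m → T k <± ⊤±
    T<⊤ {zero}  _   = subst (_<± ⊤±) (sym first) Strict.⊥±<⊤±
    T<⊤ {suc k} k<m = subst (_<± ⊤±) (sym (proj₂ (proj₂ (attained k<m)))) Strict.[ _ ]<⊤±

    increasing′ : ∀ {k} → k ℕ.< m ⊎ k ≡ m → T′ k <± T′ (suc k)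
    increasing′ (inj₁ k<m)  = subst₂ _<±_ (sym (old (ℕ.<⇒≤ k<m))) (sym (old k<m)) (increasing k<m)
    increasing′ (inj₂ refl) = subst₂ _<±_ (sym (old ℕ.≤-refl)) (sym new) (T<⊤ ℕ.≤-refl)

  -- Any initial memory will do: τ_0 is written first, and ranks matter only for deadlines up to
  -- τ_m, of which there are none at the start.
  wp-sortDeadlines : ∀ {e} → wp (Algorithm.sortDeadlines n) (λ m e′ → Sorted m (e′ τ 0) (e′ rank 0)) e
  wp-sortDeadlines = refl , (ℕ.z<s , ℕ.≤-trans ℕ.z<s (ℕ.m≤n+m 2 n)) ,
    wp-loop n (λ c m e → Prefix c m (e τ 0) (e rank 0)) z≤n
      (λ { {c} {m} {e} _ c<n prefix →
           (ℕ.z<s , ℕ.≤-trans (s≤s (ℕ.≤-trans (Prefix.m≤c prefix) (ℕ.<⇒≤ c<n))) (ℕ.m<m+n n ℕ.z<s)) ,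
           wp-nextDeadline (e τ 0 m) λ
             { {nothing} next → prefix-idle prefix next
             ; {just t}  next → refl , (ℕ.z<s , cell (ℕ.≤-trans (Prefix.m≤c prefix) (ℕ.<⇒≤ c<n))) ,
                 wp-setRanks (m ℕ.+ 1) t λ {e′} ranked →
                   -- The program computes `m ℕ.+ 1`, the invariant speaks of `suc m`.
                   subst (λ m → Prefix (suc c) m (e′ τ 0) (e′ rank 0)) (ℕ.+-comm 1 m)
                     (prefix-extend prefix next
                       (trans (kept ranked (suc m)) (new-entry (e τ 0) m))
                       (λ {k} k≤m → trans (kept ranked k) (old-entry (e τ 0) k≤m))
                       (λ r<n d≡t → trans (Ranked.hit ranked r<n d≡t) (ℕ.+-comm m 1))
                       (Ranked.miss ranked)) } })
      (λ { {m} {e} prefix → refl , (ℕ.z<s , cell (Prefix.m≤c prefix)) ,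
           prefix-sorted prefix (new-entry (e τ 0) m) (old-entry (e τ 0)) })
      (prefix-⊥ refl)
    where
    old-entry : ∀ (T : ℕ → Carrier ±) {m k v} → k ℕ.≤ m → (if m ℕ.+ 1 ≡ᵇ k then v else T k) ≡ T k
    old-entry _ {m} {k} k≤m = not-updated {i = 0} {m ℕ.+ 1} {0} {k}
      (inj₂ λ { refl → ℕ.<⇒≱ (ℕ.m<m+n m ℕ.z<s) k≤m })

    new-entry : ∀ (T : ℕ → Carrier ±) m {v} → (if m ℕ.+ 1 ≡ᵇ suc m then v else T (suc m)) ≡ v
    new-entry T m {v} = subst (λ k → (if m ℕ.+ 1 ≡ᵇ k then v else T k) ≡ v)
      (ℕ.+-comm m 1) (updated 0 (m ℕ.+ 1))

    cell : ∀ {m} → m ℕ.≤ n → m ℕ.+ 1 ℕ.< n ℕ.+ 2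
    cell m≤n = ℕ.+-mono-≤-< m≤n ℕ.≤-refl

    kept : ∀ {k t c e e′} → Ranked k t c e e′ → ∀ l → e′ τ 0 l ≡ e τ 0 l
    kept ranked l = cong (λ f → f 0 l) (Ranked.τ-kept ranked)

-- Filling the tables

module Filling (R : OrderedGroup) {n : ℕ} (I : LAD.Instance R n)
  {m : ℕ} {T : ℕ → OrderedGroup.Carrier R ±} {rk : ℕ → ℕ}
  (sorted : Subproblems.Sorted R I m T rk) where
  open OrderedGroup R
  open Numbers R
  open Semantics R hiding (size; entry; output; time; heap; depth; space)
  open Logic R
  open Subproblems R I
  open Sorted sorted
  open WithDeadlines sorted

  inputs+deadlines : Memory
  inputs+deadlines rel   _ = a
  inputs+deadlines loc   _ = x
  inputs+deadlines dl    _ = d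
  inputs+deadlines τ     _ = T
  inputs+deadlines rank  _ = rk
  inputs+deadlines mark  _ _ = false
  inputs+deadlines F     _ _ = 0#
  inputs+deadlines split _ _ = nothing
  inputs+deadlines pivot _ _ = nothing

  dynamic-tables : Table → Bool
  dynamic-tables mark  = true
  dynamic-tables F     = true
  dynamic-tables split = true
  dynamic-tables pivot = true
  dynamic-tables _     = false

  open Precondition (layout n (m ℕ.+ 2)) dynamic-tables inputs+deadlines

  private
    below-m+2 : ∀ {k} → k ℕ.≤ suc m → k ℕ.< m ℕ.+ 2
    below-m+2 {k} k≤m+1 = subst (k ℕ.<_) (ℕ.+-comm 2 m) (s≤s k≤m+1)

    below-n+2 : ∀ {k} → k ℕ.≤ suc m → k ℕ.< n ℕ.+ 2
    below-n+2 k≤m+1 = ℕ.≤-trans (below-m+2 k≤m+1) (ℕ.+-monoˡ-≤ 2 m≤n)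

  -- Scanning for the pivot

  data Pivot (i j k : ℕ) : Maybe (ℕ × Carrier) → Set where
    none : (∀ {r} → r ℕ.< k → ¬ In i j r) → Pivot i j k nothing
    some : ∀ {p} → p ℕ.< n → In i j p → (∀ {r} → r ℕ.< k → In i j r → x r ≤ x p) →
           Pivot i j k (just (p , x p))

  record Scanned (i j k : ℕ) (v : Maybe (ℕ × Carrier)) (e e′ : Memory) : Set where
    field
      F-kept     : e′ F ≡ e F
      split-kept : e′ split ≡ e split
      pivot-kept : e′ pivot ≡ e pivot
      chosen     : Pivot i j k v
      -- The converse is not needed: every k with a_p ≤ τ_k ≤ d_p is a sound split.
      marked     : ∀ {r} → r ℕ.< k → In i j r → e′ mark 0 (rk r) ≡ true

  private
    module _ {i j k : ℕ} {e e′ : Memory} where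

      skip : ∀ {v} → Scanned i j k v e e′ → ¬ In i j k → Scanned i j (suc k) v e e′
      skip {v} scanned k∉I = record
        { F-kept = F-kept ; split-kept = split-kept ; pivot-kept = pivot-kept
        ; chosen = chosen′ chosen
        ; marked = below-suc marked λ k∈I → contradiction k∈I k∉I }
        where
        open Scanned scanned
        chosen′ : Pivot i j k v → Pivot i j (suc k) v
        chosen′ (none empty)         = none (below-suc empty k∉I)
        chosen′ (some p<n p∈I large) = some p<n p∈I (below-suc large λ k∈I → contradiction k∈I k∉I)

      visit : ∀ {v v′} → Scanned i j k v e e′ → Pivot i j (suc k) v′ →
              Scanned i j (suc k) v′ e (setEntry mark 0 (rk k) true e′)
      visit scanned chosen′ = record
        { F-kept = F-kept ; split-kept = split-kept ; pivot-kept = pivot-kept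
        ; chosen = chosen′
        ; marked = below-suc
            {P = λ r → In i j r → (if rk k ≡ᵇ rk r then true else e′ mark 0 (rk r)) ≡ true}
            (λ {r} r<k r∈I → still-true (rk k ≡ᵇ rk r) (marked r<k r∈I)) (λ _ → updated 0 (rk k)) }
        where
        open Scanned scanned
        still-true : ∀ b {c} → c ≡ true → (if b then true else c) ≡ true
        still-true true  _      = refl
        still-true false c≡true = c≡true

      visit-first : Scanned i j k nothing e e′ → k ℕ.< n → In i j k → Pivot i j (suc k) (just (k , x k))
      visit-first scanned k<n k∈I with Scanned.chosen scanned
      ... | none empty = some k<n k∈I
              (below-suc {P = λ r → In i j r → x r ≤ x k}
                (λ r<k r∈I → contradiction r∈I (empty r<k)) λ _ → ≤-refl)

      visit-larger : ∀ {p y} → Scanned i j k (just (p , y)) e e′ → k ℕ.< n → In i j k → y ≤ x k →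
                     Pivot i j (suc k) (just (k , x k))
      visit-larger scanned k<n k∈I y≤xk with Scanned.chosen scanned
      ... | some _ _ large = some k<n k∈I
              (below-suc {P = λ r → In i j r → x r ≤ x k}
                (λ r<k r∈I → ≤-trans (large r<k r∈I) y≤xk) λ _ → ≤-refl)

      visit-smaller : ∀ {p y} → Scanned i j k (just (p , y)) e e′ → x k ≤ y → Pivot i j (suc k) (just (p , y))
      visit-smaller scanned xk≤y with Scanned.chosen scanned
      ... | some p<n p∈I large = some p<n p∈I (below-suc large λ _ → xk≤y)

  wp-scan : ∀ {i j} {Q : Maybe (ℕ × Carrier) → Memory → Set} {e} → i ℕ.< j → j ℕ.≤ suc m →
    (∀ {v e′} → Scanned i j n v e e′ → Q v e′) → wp (Algorithm.scan n i j) Q e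
  wp-scan {i} {j} {e = e} i<j j≤m+1 q =
    (ℕ.z<s , below-n+2 (ℕ.≤-trans (ℕ.<⇒≤ i<j) j≤m+1)) , (ℕ.z<s , below-n+2 j≤m+1) ,
    wp-loop j (λ _ _ e′ → e′ F ≡ e F × e′ split ≡ e split × e′ pivot ≡ e pivot) (ℕ.<⇒≤ i<j)
      (λ _ k<j kept → refl , (ℕ.z<s , below-m+2 (ℕ.≤-trans (ℕ.<⇒≤ k<j) j≤m+1)) , kept)
      (λ (F-kept , split-kept , pivot-kept) →
        wp-loop n (λ k v e′ → Scanned i j k v e e′) z≤n
          (λ { {k} {nothing} _ k<n scanned → (ℕ.z<s , k<n) , (ℕ.z<s , k<n) ,
               wp-≤ᵉ [ a k ] (T i) λ
                 { (ofʸ ≮a)  → wp-≤ᵉ (T j) [ d k ] λ _ → skip scanned λ (<a , _) → ≮a <a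
                 ; (ofⁿ ¬≮a) → wp-≤ᵉ (T j) [ d k ] λ
                     { (ofʸ d≮)  → skip scanned λ (_ , d<) → d≮ d<
                     ; (ofⁿ ¬d≮) → (ℕ.z<s , k<n) , refl ,
                         (ℕ.z<s , below-m+2 (ℕ.m≤n⇒m≤1+n (rank≤m k<n))) , (ℕ.z<s , k<n) ,
                         visit scanned (visit-first scanned k<n (<±-stable ¬≮a , <±-stable ¬d≮)) } }
             ; {k} {just (_ , _)} _ k<n scanned → (ℕ.z<s , k<n) , (ℕ.z<s , k<n) ,
               wp-≤ᵉ [ a k ] (T i) λ
                 { (ofʸ ≮a)  → wp-≤ᵉ (T j) [ d k ] λ _ → skip scanned λ (<a , _) → ≮a <a
                 ; (ofⁿ ¬≮a) → wp-≤ᵉ (T j) [ d k ] λ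
                     { (ofʸ d≮)  → skip scanned λ (_ , d<) → d≮ d<
                     ; (ofⁿ ¬d≮) → (ℕ.z<s , k<n) , refl ,
                         (ℕ.z<s , below-m+2 (ℕ.m≤n⇒m≤1+n (rank≤m k<n))) , (ℕ.z<s , k<n) ,
                         wp-before
                           (visit scanned ∘ visit-larger scanned k<n (<±-stable ¬≮a , <±-stable ¬d≮))
                           (visit scanned ∘ visit-smaller scanned) } } })
          q
          record { F-kept = F-kept ; split-kept = split-kept ; pivot-kept = pivot-kept
                 ; chosen = none λ () ; marked = λ () })
      (refl , refl , refl)

  -- Choosing the split

  data Best (φ : ℕ → ℕ → Carrier) (i j p k : ℕ) : Maybe (ℕ × Carrier) → Set where
    none : (∀ {l} → l ℕ.< k → ¬ Candidate i j p l) → Best φ i j p k nothing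
    some : ∀ {l t} → i ℕ.< l → l ℕ.< j → T l ≡ [ t ] → a p ≤ t → t ≤ d p →
           (∀ {l′} → l′ ℕ.< k → Candidate i j p l′ → φ i l + φ l j ≤ φ i l′ + φ l′ j) →
           Best φ i j p k (just (l , φ i l + φ l j))

  private
    module _ {φ : ℕ → ℕ → Carrier} {i j p k : ℕ} where

      best-skip : ∀ {v} → Best φ i j p k v → ¬ Candidate i j p k → Best φ i j p (suc k) v
      best-skip (none no-candidate) no-k = none (below-suc no-candidate no-k)
      best-skip (some i<l l<j Tl≡t a≤t t≤d least) no-k =
        some i<l l<j Tl≡t a≤t t≤d (below-suc least λ yes-k → contradiction yes-k no-k)

      best-new : ∀ {t v} → Best φ i j p k v → i ℕ.< k → k ℕ.< j → T k ≡ [ t ] × a p ≤ t × t ≤ d p →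
        (∀ {l y} → v ≡ just (l , y) → φ i k + φ k j ≤ y) →
        Best φ i j p (suc k) (just (k , φ i k + φ k j))
      best-new best i<k k<j (Tk≡t , a≤t , t≤d) smaller = some i<k k<j Tk≡t a≤t t≤d
        (below-suc {P = λ l → Candidate i j p l → φ i k + φ k j ≤ φ i l + φ l j}
          (earlier best smaller) (λ _ → ≤-refl))
        where
        earlier : ∀ {v} → Best φ i j p k v → (∀ {l y} → v ≡ just (l , y) → φ i k + φ k j ≤ y) →
          ∀ {l} → l ℕ.< k → Candidate i j p l → φ i k + φ k j ≤ φ i l + φ l j
        earlier (none no-candidate)    _       l<k yes-l = contradiction yes-l (no-candidate l<k)
        earlier (some _ _ _ _ _ least) smaller l<k yes-l = ≤-trans (smaller refl) (least l<k yes-l)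

      best-old : ∀ {l y} → Best φ i j p k (just (l , y)) → y ≤ φ i k + φ k j →
        Best φ i j p (suc k) (just (l , y))
      best-old (some i<l l<j Tl≡t a≤t t≤d least) y≤ = some i<l l<j Tl≡t a≤t t≤d (below-suc least λ _ → y≤)

    finite : ∀ {k} → 0 ℕ.< k → k ℕ.≤ m → ∃[ t ] (T k ≡ [ t ])
    finite {k} 0<k k≤m with T k | T-mono 0<k (ℕ.m≤n⇒m≤1+n k≤m) | T-mono (s≤s k≤m) ℕ.≤-refl
    ... | ⊥±    | T0<⊥ | _  = contradiction T0<⊥ ≮⊥±
    ... | [ t ] | _    | _  = t , refl
    ... | ⊤±    | _    | ()

    eligible : ∀ {i j p k} b {b₁ b₂} → i ℕ.< k → k ℕ.< j → j ℕ.≤ suc m →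
      Reflects (¬ (T k <± [ a p ])) b₁ → Reflects (¬ ([ d p ] <± T k)) b₂ → b ∧ b₁ ∧ b₂ ≡ true →
      ∃[ t ] (T k ≡ [ t ] × a p ≤ t × t ≤ d p)
    eligible {i} {p = p} {k} true i<k k<j j≤m+1 (ofʸ ≮a) (ofʸ d≮) _
      with t , Tk≡t ← finite (ℕ.≤-trans (s≤s z≤n) i<k) (ℕ.s≤s⁻¹ (ℕ.≤-trans k<j j≤m+1)) =
      t , Tk≡t , ≮⇒≥ (λ t<a → ≮a (subst (_<± [ a p ]) (sym Tk≡t) Strict.[ t<a ]))
               , ≮⇒≥ (λ d<t → d≮ (subst ([ d p ] <±_) (sym Tk≡t) Strict.[ d<t ]))

    -- A candidate passes all three tests: its witness `r` has set the mark, and its bounds on `t`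
    -- contradict either failed comparison.
    ineligible : ∀ {i j p k} b {b₁ b₂} → (∀ {r} → r ℕ.< n → In i j r → rk r ≡ k → b ≡ true) →
      Reflects (¬ (T k <± [ a p ])) b₁ → Reflects (¬ ([ d p ] <± T k)) b₂ → b ∧ b₁ ∧ b₂ ≡ false →
      ¬ Candidate i j p k
    ineligible {p = p} {k} b marked (ofⁿ <a) _ _ candidate = <a λ Tk<a →
      <⇒≱ ([<]-injective (subst (_<± [ a p ]) Tk≡t Tk<a)) a≤t
      where open Candidate candidate
    ineligible {p = p} {k} b marked (ofʸ _) (ofⁿ d<) _ candidate = d< λ d<Tk →
      <⇒≱ ([<]-injective (subst ([ d p ] <±_) Tk≡t d<Tk)) t≤d
      where open Candidate candidate
    ineligible {p = p} {k} b marked (ofʸ _) (ofʸ _) b≡false candidate =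
      contradiction (trans (sym (cong (_∧ true) (marked r<n r∈I rank-r))) b≡false) λ ()
      where open Candidate candidate

  wp-bestSplit : ∀ {i j p} {Q : Maybe (ℕ × Carrier) → Memory → Set} {e} →
    i ℕ.< j → j ℕ.≤ suc m → p ℕ.< n → (∀ {r} → r ℕ.< n → In i j r → e mark 0 (rk r) ≡ true) →
    (∀ {v} → Best (e F) i j p j v → Q v e) → wp (Algorithm.bestSplit i j p) Q e
  wp-bestSplit {i} {j} {p} {e = e} i<j j≤m+1 p<n marked q =
    (ℕ.z<s , p<n) , (ℕ.z<s , p<n) ,
    wp-loop j (λ k v e′ → e′ ≡ e × Best (e F) i j p k v)
      (subst (ℕ._≤ j) (ℕ.+-comm 1 i) i<j)
      (λ { {k} {nothing} i+1≤k k<j (refl , best) → mark-cell k<j , τ-cell k<j ,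
             wp-≤ᵉ [ a p ] (T k) λ {b₁} r₁ → wp-≤ᵉ (T k) [ d p ] λ {b₂} r₂ → wp-if (e mark 0 k ∧ b₁ ∧ b₂)
               (λ ok → F-cells (after i+1≤k) k<j .proj₁ , F-cells (after i+1≤k) k<j .proj₂ , refl ,
                 best-new best (after i+1≤k) k<j
                   (proj₂ (eligible (e mark 0 k) (after i+1≤k) k<j j≤m+1 r₁ r₂ ok)) λ ())
               (λ ¬ok → refl , best-skip best (ineligible (e mark 0 k) (is-marked k) r₁ r₂ ¬ok))
         ; {k} {just (_ , _)} i+1≤k k<j (refl , best) → mark-cell k<j , τ-cell k<j ,
             wp-≤ᵉ [ a p ] (T k) λ {b₁} r₁ → wp-≤ᵉ (T k) [ d p ] λ {b₂} r₂ → wp-if (e mark 0 k ∧ b₁ ∧ b₂)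
               (λ ok → F-cells (after i+1≤k) k<j .proj₁ , F-cells (after i+1≤k) k<j .proj₂ , wp-before
                 (λ new≤ → refl , best-new best (after i+1≤k) k<j
                   (proj₂ (eligible (e mark 0 k) (after i+1≤k) k<j j≤m+1 r₁ r₂ ok)) λ { refl → new≤ })
                 (λ old≤ → refl , best-old best old≤))
               (λ ¬ok → refl , best-skip best (ineligible (e mark 0 k) (is-marked k) r₁ r₂ ¬ok)) })
      (λ { (refl , best) → q best })
      -- The loop starts at i + 1, and no candidate is at most `i`.
      (refl , none λ {l} l<i+1 candidate →
        ℕ.<⇒≱ (Candidate.i<k candidate) (ℕ.s≤s⁻¹ (subst (l ℕ.<_) (ℕ.+-comm i 1) l<i+1)))
    where
    after : ∀ {k} → i ℕ.+ 1 ℕ.≤ k → i ℕ.< k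
    after {k} = subst (ℕ._≤ k) (ℕ.+-comm i 1)

    k≤m+1 : ∀ {k} → k ℕ.< j → k ℕ.≤ suc m
    k≤m+1 k<j = ℕ.≤-trans (ℕ.<⇒≤ k<j) j≤m+1

    mark-cell : ∀ {k} → k ℕ.< j → Cell mark 0 k
    mark-cell k<j = ℕ.z<s , below-m+2 (k≤m+1 k<j)

    τ-cell : ∀ {k} → k ℕ.< j → Cell τ 0 k
    τ-cell k<j = ℕ.z<s , below-n+2 (k≤m+1 k<j)

    F-cells : ∀ {k} → i ℕ.< k → k ℕ.< j → Cell F i k × Cell F k j
    F-cells i<k k<j = (below-m+2 (ℕ.≤-trans (ℕ.<⇒≤ i<k) (k≤m+1 k<j)) , below-m+2 (k≤m+1 k<j)) ,
                      (below-m+2 (k≤m+1 k<j) , below-m+2 j≤m+1)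

    is-marked : ∀ k {r} → r ℕ.< n → In i j r → rk r ≡ k → e mark 0 k ≡ true
    is-marked _ r<n r∈I refl = marked r<n r∈I

  -- Filling one cell, then all cells

  SolvedIn : Memory → ℕ → ℕ → Set
  SolvedIn e = Tables.Solved (e F) (e split) (e pivot)

  AgreeAt : Memory → Memory → ℕ → ℕ → Set
  AgreeAt e e′ i j = e′ F i j ≡ e F i j × e′ split i j ≡ e split i j × e′ pivot i j ≡ e pivot i j

  solved-cong : ∀ {e e′ i j} → AgreeAt e e′ i j →
    (∀ {k} → i ℕ.< k → k ℕ.< j → AgreeAt e e′ i k × AgreeAt e e′ k j) →
    SolvedIn e i j → SolvedIn e′ i j
  solved-cong (φ≡ , κ≡ , π≡) inner (Tables.empty κ⊥ no-request φ0) =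
    Tables.empty (trans κ≡ κ⊥) no-request (trans φ≡ φ0)
  solved-cong {i = i} {j} (φ≡ , κ≡ , π≡) inner (Tables.serve {p = p} κk πp served φ-sum lower) =
    Tables.serve (trans κ≡ κk) (trans π≡ πp) served
      (trans φ≡ (trans φ-sum (cong (x p +_) (cong₂ _+_ (sym (proj₁ left)) (sym (proj₁ right))))))
      (subst (LowerBound i j) (sym φ≡) lower)
    where
    open Serves served
    left  = proj₁ (inner i<k k<j)
    right = proj₂ (inner i<k k<j)

  Elsewhere : ℕ → ℕ → Memory → Memory → Set
  Elsewhere i j e e′ = ∀ k l → k ≢ i ⊎ l ≢ j → AgreeAt e e′ k l

  wp-fill : ∀ {i j e} → i ℕ.< j → j ℕ.≤ suc m →
    (∀ {k l} → k ℕ.< l → l ℕ.≤ suc m → l ∸ k ℕ.< j ∸ i → SolvedIn e k l) →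
    wp (Algorithm.fill n i j) (λ _ e′ → SolvedIn e′ i j × Elsewhere i j e e′) e
  wp-fill {i} {j} {e} i<j j≤m+1 smaller = wp-scan i<j j≤m+1 λ
    { {nothing} scanned → refl , cell , refl , cell , refl , cell ,
        solved-empty scanned , elsewhere scanned
    ; {just (p , _)} {e′} scanned → wp-bestSplit i<j j≤m+1 (pivot<n scanned) (Scanned.marked scanned) λ
        { {nothing} best → contradiction (proj₂ (pivot-candidate scanned))
                             (no-candidate best (pivot-candidate scanned))
        ; {just (k , _)} best → refl , cell , refl , cell , refl , cell ,
            solved-serve scanned best , elsewhere scanned } }
    where
    i≤m+1 : i ℕ.≤ suc m
    i≤m+1 = ℕ.≤-trans (ℕ.<⇒≤ i<j) j≤m+1

    cell : i ℕ.< m ℕ.+ 2 × j ℕ.< m ℕ.+ 2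
    cell = below-m+2 i≤m+1 , below-m+2 j≤m+1

    filled : Carrier → Maybe ℕ → Maybe ℕ → Memory → Memory
    filled v k p e = setEntry pivot i j p (setEntry split i j k (setEntry F i j v e))

    elsewhere : ∀ {u v k p e′} → Scanned i j n u e e′ → Elsewhere i j e (filled v k p e′)
    elsewhere {e′ = e′} scanned k l away =
      trans (unchanged away) (cong (λ f → f k l) F-kept) ,
      trans (unchanged away) (cong (λ f → f k l) split-kept) ,
      trans (unchanged away) (cong (λ f → f k l) pivot-kept)
      where
      open Scanned scanned
      unchanged : ∀ {A : Set} {v w : A} → k ≢ i ⊎ l ≢ j → (if (i ≡ᵇ k) ∧ (j ≡ᵇ l) then v else w) ≡ w
      unchanged (inj₁ k≢i) = not-updated {i = i} {j} {k} {l} (inj₁ (k≢i ∘ sym))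
      unchanged (inj₂ l≢j) = not-updated {i = i} {j} {k} {l} (inj₂ (l≢j ∘ sym))

    solved-empty : ∀ {e′} → Scanned i j n nothing e e′ → SolvedIn (filled 0# nothing nothing e′) i j
    solved-empty scanned with Scanned.chosen scanned
    ... | none empty = Tables.empty (updated i j) empty (updated i j)

    pivot<n : ∀ {p y e′} → Scanned i j n (just (p , y)) e e′ → p ℕ.< n
    pivot<n scanned with Scanned.chosen scanned
    ... | some p<n _ _ = p<n

    -- The pivot's own deadline is an admissible split, so K(i,j) is nonempty and `abort` is never
    -- reached.
    pivot-candidate : ∀ {p y e′} → Scanned i j n (just (p , y)) e e′ → rk p ℕ.< j × Candidate i j p (rk p)
    pivot-candidate {p} scanned with Scanned.chosen scanned
    ... | some p<n (Ti<a , d<Tj) _ = k<j , record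
      { i<k = T-cancel i≤m+1 (subst (T i <±_) (sym (T-rank p<n)) (<±-≤-trans Ti<a (a≤d p<n)))
      ; k<j = k<j ; Tk≡t = T-rank p<n ; a≤t = a≤d p<n ; t≤d = ≤-refl
      ; r<n = p<n ; r∈I = Ti<a , d<Tj ; rank-r = refl }
      where
      k<j : rk p ℕ.< j
      k<j = T-cancel (ℕ.m≤n⇒m≤1+n (rank≤m p<n)) (subst (_<± T j) (sym (T-rank p<n)) d<Tj)

    no-candidate : ∀ {φ p k} → Best φ i j p j nothing → k ℕ.< j × Candidate i j p k → ¬ Candidate i j p k
    no-candidate (none absent) (k<j , _) = absent k<j

    solved-serve : ∀ {p y k z e′} → Scanned i j n (just (p , y)) e e′ → Best (e′ F) i j p j (just (k , z)) →
      SolvedIn (filled (y + z) (just k) (just p) e′) i j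
    solved-serve {p} {e′ = e′} scanned (some {l = l} {t} i<l l<j Tl≡t a≤t t≤d least)
      with Scanned.chosen scanned
    ... | some p<n p∈I large = Tables.serve (updated i j) (updated i j)
        (record { i<k = i<l ; k<j = l<j ; Tk≡t = Tl≡t ; p<n = p<n ; a≤t = a≤t ; t≤d = t≤d ; maximum = large })
        (trans (updated i j) (cong (x p +_) (cong₂ _+_
          (sym (not-updated {i = i} {j} {i} {l} (inj₂ (ℕ.<⇒≢ l<j ∘ sym))))
          (sym (not-updated {i = i} {j} {l} {j} (inj₁ (ℕ.<⇒≢ i<l)))))))
        (subst (LowerBound i j) (sym (updated i j))
          (lowerBound-pivot i≤m+1 j≤m+1 p<n p∈I λ {k} candidate →
            let open Candidate candidate using (i<k; k<j) in
            e′ F i k , e′ F k j ,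
            -- The hypothesis `smaller` concerns the memory before the scan, the minimum the memory
            -- after it; the scan leaves `F` unchanged.
            subst (λ φ → LowerBound i k (φ i k)) (sym (Scanned.F-kept scanned))
              (Tables.lowerBound _ _ _
                (smaller i<k (ℕ.≤-trans (ℕ.<⇒≤ k<j) j≤m+1) (ℕ.∸-monoˡ-< k<j (ℕ.<⇒≤ i<k)))) ,
            subst (λ φ → LowerBound k j (φ k j)) (sym (Scanned.F-kept scanned))
              (Tables.lowerBound _ _ _ (smaller k<j j≤m+1 (ℕ.∸-monoʳ-< i<k (ℕ.<⇒≤ k<j)))) ,
            least k<j candidate))

  -- The main loop of `lad` with its registers replaced by their values, so that it agrees by
  -- computation with what `lad` executes.
  fillAll : Code unit
  fillAll = for 1 (m ℕ.+ 2) λ w → do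
    hi ← sub (m ℕ.+ 2) w
    for 0 hi λ i → do
      j ← add i w
      fill n i j
    where open Algorithm

  -- Filling by increasing width works because the recurrence for (i,j) reads only narrower cells.
  -- `Narrower` is the outer invariant; `Row` adds the part of the current width already filled.
  wp-fillAll : ∀ {e} → wp fillAll (λ _ e′ → ∀ i j → i ℕ.< j → j ℕ.≤ suc m → SolvedIn e′ i j) e
  wp-fillAll = wp-loop (m ℕ.+ 2) (λ w _ e → Narrower w e) (ℕ.≤-trans (ℕ.n≤1+n 1) (ℕ.m≤n+m 2 m))
    (λ { {w} 1≤w w<m+2 narrower → wp-loop (m ℕ.+ 2 ∸ w) (λ i _ e → Narrower w e × Row w i e) z≤n
      (λ { {i} {_} {e} _ i<hi (narrower , row) →
        wp-mono (Algorithm.fill n i (i ℕ.+ w)) (λ {_} {e′} → next {e = e} {e′} narrower row)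
          (wp-fill (ℕ.m<m+n i 1≤w) (fits w<m+2 i<hi) λ {k} {l} k<l l≤m+1 narrow →
            narrower k l k<l l≤m+1 (subst (l ∸ k ℕ.<_) (ℕ.m+n∸m≡n i w) narrow)) })
      (λ { {_} {e} (narrower , row) → widen {w} {e} narrower row })
      (narrower , λ ()) })
    (λ narrower i j i<j j≤m+1 → narrower i j i<j j≤m+1 (below-m+2 (ℕ.≤-trans (ℕ.m∸n≤m j i) j≤m+1)))
    (λ _ _ i<j _ j∸i<1 → contradiction (ℕ.m<n⇒0<n∸m i<j) (ℕ.<⇒≱ j∸i<1))
    where
    Narrower : ℕ → Memory → Set
    Narrower w e = ∀ i j → i ℕ.< j → j ℕ.≤ suc m → j ∸ i ℕ.< w → SolvedIn e i j

    Row : ℕ → ℕ → Memory → Set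
    Row w i e = ∀ {k} → k ℕ.< i → k ℕ.+ w ℕ.≤ suc m → SolvedIn e k (k ℕ.+ w)

    fits : ∀ {w i} → w ℕ.< m ℕ.+ 2 → i ℕ.< m ℕ.+ 2 ∸ w → i ℕ.+ w ℕ.≤ suc m
    fits {w} {i} w<m+2 i<hi = ℕ.s≤s⁻¹ (begin-strict
      i ℕ.+ w                <⟨ ℕ.+-monoˡ-< w i<hi ⟩
      (m ℕ.+ 2 ∸ w) ℕ.+ w    ≡⟨ ℕ.m∸n+n≡m (ℕ.<⇒≤ w<m+2) ⟩
      m ℕ.+ 2                ≡⟨ ℕ.+-comm m 2 ⟩
      2 ℕ.+ m                ∎)
      where open ℕ.≤-Reasoning

    widen : ∀ {w e} → Narrower w e → Row w (m ℕ.+ 2 ∸ w) e → Narrower (suc w) e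
    widen {w} {e} narrower row i j i<j j≤m+1 j∸i<1+w with ℕ.m≤n⇒m<n∨m≡n (ℕ.s≤s⁻¹ j∸i<1+w)
    ... | inj₁ j∸i<w = narrower i j i<j j≤m+1 j∸i<w
    ... | inj₂ refl  = subst (SolvedIn e i) i+w≡j (row
            (subst (ℕ._< m ℕ.+ 2 ∸ w) (ℕ.m+n∸n≡m i w)
              (ℕ.∸-monoˡ-< (subst (ℕ._< m ℕ.+ 2) (sym i+w≡j) (below-m+2 j≤m+1)) (ℕ.m≤n+m w i)))
            (subst (ℕ._≤ suc m) (sym i+w≡j) j≤m+1))
      where
      i+w≡j : i ℕ.+ w ≡ j
      i+w≡j = ℕ.m+[n∸m]≡n (ℕ.<⇒≤ i<j)

    -- The written cell has width `w` and starts at `i`. All cells on which earlier results rest are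
    -- narrower or start before `i`, so `solved-cong` preserves those results.
    next : ∀ {w i e e′} → Narrower w e → Row w i e → SolvedIn e′ i (i ℕ.+ w) × Elsewhere i (i ℕ.+ w) e e′ →
      Narrower w e′ × Row w (suc i) e′
    next {w} {i} {e} {e′} narrower row (new , elsewhere) =
      (λ k l k<l l≤m+1 l∸k<w → solved-cong {e} {e′} (narrow {l} {k} l∸k<w)
        (inner (ℕ.<⇒≤ l∸k<w)) (narrower k l k<l l≤m+1 l∸k<w)) ,
      below-suc {P = λ k → k ℕ.+ w ℕ.≤ suc m → SolvedIn e′ k (k ℕ.+ w)}
        (λ {k} k<i k+w≤m+1 → solved-cong {e} {e′} (elsewhere _ _ (inj₁ (ℕ.<⇒≢ k<i)))
          (inner (ℕ.≤-reflexive (ℕ.m+n∸m≡n k w))) (row k<i k+w≤m+1))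
        (λ _ → new)
      where
      narrow : ∀ {l k} → l ∸ k ℕ.< w → AgreeAt e e′ k l
      narrow {l} {k} l∸k<w with k ℕ.≟ i
      ... | no k≢i   = elsewhere _ _ (inj₁ k≢i)
      ... | yes refl = elsewhere _ _ (inj₂ λ { refl → ℕ.<⇒≢ l∸k<w (ℕ.m+n∸m≡n k w) })

      inner : ∀ {k l q} → l ∸ k ℕ.≤ w → k ℕ.< q → q ℕ.< l → AgreeAt e e′ k q × AgreeAt e e′ q l
      inner {k} {l} {q} l∸k≤w k<q q<l =
        narrow {q} {k} (ℕ.<-≤-trans (ℕ.∸-monoˡ-< q<l (ℕ.<⇒≤ k<q)) l∸k≤w) ,
        narrow {l} {q} (ℕ.<-≤-trans (ℕ.∸-monoʳ-< k<q (ℕ.<⇒≤ q<l)) l∸k≤w)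

open import Data.Nat.Base using (_≤_; _<_; _+_; _*_; _∸_; _^_)

-- Time and space bounds

-- The bounds below are written over an arbitrary signature, so that they can be
-- read both as numbers and as polynomials for the ring solver.  N bounds the
-- number of iterations of every loop.
module Bounds {A : Set} (_⊕_ _⊗_ : A → A → A) (# : ℕ → A) (N : A) where

  -- The bracketing here and in `fillBound` and `fillAllBound` follows the program text, so that the
  -- sums arising in a `Within` derivation match by computation.
  sortBound : A
  sortBound = # 3 ⊕ ((# 1 ⊕ (N ⊗ (# 1 ⊕ (# 2 ⊕ ((# 2 ⊕ (N ⊗ # 5)) ⊕
    (# 4 ⊕ ((# 2 ⊕ (N ⊗ # 7)) ⊕ # 0))))))) ⊕ # 4)

  fillBound : A
  fillBound = (# 4 ⊕ ((# 1 ⊕ (N ⊗ # 3)) ⊕ (# 1 ⊕ (# 1 ⊕ (N ⊗ # 16))))) ⊕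
    ((# 6 ⊕ (# 1 ⊕ (N ⊗ # 13))) ⊕ # 4)

  fillAllBound : A
  fillAllBound = # 1 ⊕ (N ⊗ (# 1 ⊕ (# 1 ⊕ (# 1 ⊕ (N ⊗ (# 1 ⊕ (# 1 ⊕ fillBound)))))))

  -- The summands are in reverse order of execution: Build, the read of the result, the main loop,
  -- allocation of `pivot`, `split`, `F` and `mark`, then sorting, then allocation of `rank` and
  -- `τ`, with single steps between.
  timeBound : A
  timeBound = (# 1 ⊕ ((# 11 ⊗ N) ⊕ # 2)) ⊕ (# 1 ⊕ (fillAllBound ⊕
    ((# 1 ⊕ (N ⊗ N)) ⊕ ((# 1 ⊕ (N ⊗ N)) ⊕ ((# 1 ⊕ (N ⊗ N)) ⊕ ((# 1 ⊕ N) ⊕ (# 4 ⊕ (sortBound ⊕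
    ((# 1 ⊕ N) ⊕ (# 1 ⊕ ((# 1 ⊕ N) ⊕ # 5)))))))))))

  -- Input, `τ`, `rank`, `mark`, `F`, `split` and `pivot`, in this order; an entry of the last two
  -- takes two words because of the sentinel.
  heapBound : A
  heapBound = ((((((# 3 ⊗ N) ⊕ (# 1 ⊗ N)) ⊕ (# 1 ⊗ N)) ⊕ (# 1 ⊗ N)) ⊕
    (# 1 ⊗ (N ⊗ N))) ⊕ (# 2 ⊗ (N ⊗ N))) ⊕ (# 2 ⊗ (N ⊗ N))

  -- The output takes two words per service. The activation records are those of the main program,
  -- of the outer call of Build and of at most N calls nested in it.
  spaceBound : A
  spaceBound = (heapBound ⊕ (# 2 ⊗ N)) ⊕ (# frame ⊗ (# 1 ⊕ (# 1 ⊕ N)))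

open Bounds _+_ _*_ (λ k → k)

private
  open +-*-Solver using (solve; con; _:=_; _:+_; _:*_)
  module Polynomial {k} = Bounds {+-*-Solver.Polynomial k} _:+_ _:*_ con

  -- For N ≥ 1 each power of N is at most the highest one, so a polynomial in Horner form is bounded
  -- by the sum of its coefficients times its leading power; one use adds one coefficient.
  horner-≤ : ∀ {N h} a k j → 1 ≤ N → h ≤ k * N ^ j → a + N * h ≤ (a + k) * N ^ suc j
  horner-≤ {N@(suc _)} {h} a k j _ h≤ = begin
    a + N * h                    ≤⟨ ℕ.+-mono-≤ (ℕ.m≤m*n a (N ^ suc j)) (ℕ.*-monoʳ-≤ N h≤) ⟩
    a * N ^ suc j + N * (k * N ^ j) ≡⟨ cong (a * N ^ suc j +_) (swap N k (N ^ j)) ⟩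
    a * N ^ suc j + k * N ^ suc j   ≡⟨ ℕ.*-distribʳ-+ (N ^ suc j) a k ⟨
    (a + k) * N ^ suc j          ∎
    where
    open ℕ.≤-Reasoning
    instance _ = ℕ.m^n≢0 N (suc j)
    swap : ∀ x y z → x * (y * z) ≡ y * (x * z)
    swap = solve 3 (λ x y z → x :* (y :* z) := y :* (x :* z)) refl

  -- For n ≥ 1, n + 2 ≤ 3n.
  rescale : ∀ {n} k j → 1 ≤ n → k * (n + 2) ^ j ≤ k * 3 ^ j * n ^ j
  rescale {n} k j 1≤n = begin
    k * (n + 2) ^ j      ≤⟨ ℕ.*-monoʳ-≤ k (ℕ.^-monoˡ-≤ j (ℕ.+-monoʳ-≤ n (ℕ.*-monoʳ-≤ 2 1≤n))) ⟩
    k * (3 * n) ^ j      ≡⟨ cong (k *_) (^-distrib-* j) ⟩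
    k * (3 ^ j * n ^ j)  ≡⟨ ℕ.*-assoc k (3 ^ j) (n ^ j) ⟨
    k * 3 ^ j * n ^ j    ∎
    where
    open ℕ.≤-Reasoning
    ^-distrib-* : ∀ j → (3 * n) ^ j ≡ 3 ^ j * n ^ j
    ^-distrib-* zero    = refl
    ^-distrib-* (suc j) = trans (cong (3 * n *_) (^-distrib-* j)) (ℕ.[m*n]*[o*p]≡[m*o]*[n*p] 3 n (3 ^ j) (n ^ j))

-- The coefficients sum to 124 = 29 + 28 + 35 + 32, and 3348 = 124 * 3 ^ 3. Likewise 205 * 3 ^ 2 =
-- 1845 in `spaceBound-quadratic`.
timeBound-cubic : ∀ {n} → 1 ≤ n → timeBound (n + 2) ≤ 3348 * n ^ 3
timeBound-cubic {n} 1≤n = begin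
  timeBound N                            ≡⟨ expand N ⟩
  29 + N * (28 + N * (35 + N * 32))      ≤⟨ horner-≤ 29 95 2 1≤N (horner-≤ 28 67 1 1≤N
                                              (horner-≤ 35 32 0 1≤N ℕ.≤-refl)) ⟩
  124 * N ^ 3                            ≤⟨ rescale 124 3 1≤n ⟩
  3348 * n ^ 3                           ∎
  where
  open ℕ.≤-Reasoning
  N = n + 2
  1≤N = ℕ.≤-trans 1≤n (ℕ.m≤m+n n 2)
  expand : ∀ N → timeBound N ≡ 29 + N * (28 + N * (35 + N * 32))
  expand = solve 1 (λ N → Polynomial.timeBound N :=
    con 29 :+ N :* (con 28 :+ N :* (con 35 :+ N :* con 32))) refl

spaceBound-quadratic : ∀ {n} → 1 ≤ n → spaceBound (n + 2) ≤ 1845 * n ^ 2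
spaceBound-quadratic {n} 1≤n = begin
  spaceBound N              ≡⟨ expand N ⟩
  128 + N * (72 + N * 5)    ≤⟨ horner-≤ 128 77 1 1≤N (horner-≤ 72 5 0 1≤N ℕ.≤-refl) ⟩
  205 * N ^ 2               ≤⟨ rescale 205 2 1≤n ⟩
  1845 * n ^ 2              ∎
  where
  open ℕ.≤-Reasoning
  N = n + 2
  1≤N = ℕ.≤-trans 1≤n (ℕ.m≤m+n n 2)
  expand : ∀ N → spaceBound N ≡ 128 + N * (72 + N * 5)
  expand = solve 1 (λ N → Polynomial.spaceBound N := con 128 :+ N :* (con 72 :+ N :* con 5)) refl

module Durations (R : OrderedGroup) {n N : ℕ} (n≤N : n ≤ N) where
  open Semantics R hiding (size; entry; output; time; heap; depth; space)
  open Logic R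
  open Algorithm

  private
    ∸≤N : ∀ {hi} lo → hi ≤ N → hi ∸ lo ≤ N
    ∸≤N {hi} lo = ℕ.≤-trans (ℕ.m∸n≤m hi lo)

    within-if : ∀ {t b} c {p q : Code t} → Within b p → Within b q → Within b (if c then p else q)
    within-if true  p q = p
    within-if false p q = q

    read₁-within : ∀ {T k} → Within 2 (read₁ T k)
    read₁-within = lit >>= λ _ → read

    write₁-within : ∀ {T k v} → Within 2 (write₁ T k v)
    write₁-within = lit >>= λ _ → write

    ≤ᵉ-within : ∀ s t → Within 1 (s ≤ᵉ t)
    ≤ᵉ-within ⊥±    ⊥±    = ret
    ≤ᵉ-within ⊥±    [ y ] = ret
    ≤ᵉ-within ⊥±    ⊤±    = ret
    ≤ᵉ-within [ x ] ⊥±    = ret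
    ≤ᵉ-within [ x ] [ y ] = leqⱽ
    ≤ᵉ-within [ x ] ⊤±    = ret
    ≤ᵉ-within ⊤±    ⊥±    = ret
    ≤ᵉ-within ⊤±    [ y ] = ret
    ≤ᵉ-within ⊤±    ⊤±    = ret

    <ᵉ-within : ∀ s t → Within 1 (s <ᵉ t)
    <ᵉ-within s t = ≤ᵉ-within t s >>= λ _ → ret

    before-within : ∀ {x y} → Within 3 (before x y)
    before-within = leqⱽ >>= λ b → leqⱽ >>= λ c → within-if (b ∧ c) flip ret

  nextDeadline-within : ∀ t → Within (2 + N * 5) (nextDeadline n t)
  nextDeadline-within t = lit >>= λ z → loop (∸≤N z n≤N) λ
    { k _ nothing  → read₁-within >>= λ d → <ᵉ-within t [ d ] >>= λ b → within-if b ret ret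
    ; k _ (just _) → read₁-within >>= λ d → <ᵉ-within t [ d ] >>= λ b →
        within-if b ((leqⱽ >>= λ _ → ret {b = 0}) >>= λ _ → ret) ret }

  setRanks-within : ∀ k t → Within (2 + N * 7) (setRanks n k t)
  setRanks-within k t = lit >>= λ z → loop (∸≤N z n≤N) λ k _ _ →
    read₁-within >>= λ _ → leqⱽ >>= λ b → leqⱽ >>= λ c → within-if (b ∧ c) write₁-within ret

  sortDeadlines-within : Within (sortBound N) (sortDeadlines n)
  sortDeadlines-within = lit >>= λ z → write₁-within >>= λ _ →
    loop (∸≤N z n≤N) (λ k _ m → read₁-within >>= λ t → nextDeadline-within t >>= λ
      { nothing  → ret
      ; (just t) → lit >>= λ _ → add >>= λ k → write₁-within >>= λ _ →
          setRanks-within k t >>= λ _ → ret })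
    >>= λ _ → lit >>= λ _ → add >>= λ _ → write₁-within >>= λ _ → ret

  scan-within : ∀ {i j} → j ∸ i ≤ N → Within (4 + (suc (N * 3) + (1 + suc (N * 16)))) (scan n i j)
  scan-within j∸i≤N = read₁-within >>= λ τi → read₁-within >>= λ τj →
    loop j∸i≤N (λ _ _ _ → write₁-within) >>= λ _ → lit >>= λ z → loop (∸≤N z n≤N) λ
      { k _ nothing  → read₁-within >>= λ a → read₁-within >>= λ d →
          <ᵉ-within τi [ a ] >>= λ b → <ᵉ-within [ d ] τj >>= λ c → within-if (b ∧ c)
            (read₁-within >>= λ _ → write₁-within >>= λ _ → read₁-within >>= λ _ → ret) ret
      ; k _ (just _) → read₁-within >>= λ a → read₁-within >>= λ d →
          <ᵉ-within τi [ a ] >>= λ b → <ᵉ-within [ d ] τj >>= λ c → within-if (b ∧ c)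
            (read₁-within >>= λ _ → write₁-within >>= λ _ → read₁-within >>= λ _ →
             before-within >>= λ _ → ret) ret }

  bestSplit-within : ∀ {i j p} → j ∸ i ≤ N → Within (6 + suc (N * 13)) (bestSplit i j p)
  bestSplit-within {i} {j} j∸i≤N = read₁-within >>= λ a → read₁-within >>= λ d → lit >>= λ one → add>>=
    loop (ℕ.≤-trans (ℕ.∸-monoʳ-≤ j (ℕ.m≤m+n i one)) j∸i≤N) λ
      { k _ nothing  → read₁-within >>= λ m → read₁-within >>= λ t →
          ≤ᵉ-within [ a ] t >>= λ b → ≤ᵉ-within t [ d ] >>= λ c → within-if (m ∧ b ∧ c)
            (read >>= λ _ → read >>= λ _ → addⱽ >>= λ _ → ret) ret
      ; k _ (just _) → read₁-within >>= λ m → read₁-within >>= λ t →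
          ≤ᵉ-within [ a ] t >>= λ b → ≤ᵉ-within t [ d ] >>= λ c → within-if (m ∧ b ∧ c)
            (read >>= λ _ → read >>= λ _ → addⱽ >>= λ _ → before-within >>= λ _ → ret) ret }

  fill-within : ∀ {i j} → j ∸ i ≤ N → Within (fillBound N) (fill n i j)
  fill-within j∸i≤N = scan-within j∸i≤N >>= λ
    { nothing → slack (ℕ.m≤n+m 4 (6 + suc (N * 13))) (zeroⱽ >>= λ _ → write >>= λ _ → write >>= λ _ → write)
    ; (just _) → bestSplit-within j∸i≤N >>= λ
        { nothing → abort ; (just _) → addⱽ >>= λ _ → write >>= λ _ → write >>= λ _ → write } }

  fillAll-within : ∀ {m} → m + 2 ≤ N → Within (fillAllBound N)
    (for 1 (m + 2) λ w → sub (m + 2) w >>= λ hi → for 0 hi λ i → add i w >>= λ j → fill n i j)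
  fillAll-within {m} m+2≤N = loop (∸≤N 1 m+2≤N) λ w w<m+2 _ → sub>>=
    (loop (∸≤N w m+2≤N) λ i _ _ → add>>=
      fill-within (subst (_≤ N) (sym (ℕ.m+n∸m≡n i w)) (ℕ.≤-trans (ℕ.<⇒≤ w<m+2) m+2≤N)))

-- The procedure Build

module Building (R : OrderedGroup) {n : ℕ} (I : LAD.Instance R n)
  {m : ℕ} {T : ℕ → OrderedGroup.Carrier R ±} {rk : ℕ → ℕ}
  (sorted : Subproblems.Sorted R I m T rk) (choice : ℕ → Bool) where
  open Semantics R
  open LAD R using (Service)
  open Logic R
  open Subproblems R I
  open WithDeadlines sorted
  open Filling R I sorted using (dynamic-tables; inputs+deadlines)
  open Executions choice Algorithm.build
  open Soundness (layout n (m + 2)) dynamic-tables inputs+deadlines using (Fits)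
  open Fits

  -- From σ to σ′, the services L are emitted in at most b time units, with at
  -- most D further nested calls.
  record Emits (L : List Service) (b D : ℕ) (σ σ′ : State) : Set where
    field
      size-≡   : size σ′ ≡ size σ
      entry-≡  : entry σ′ ≡ entry σ
      output-≡ : output σ′ ≡ output σ ++ L
      heap-≡   : heap σ′ ≡ heap σ + 2 * length L
      depth-≡  : depth σ′ ≡ depth σ
      time-≤   : time σ′ ≤ b + time σ
      -- The heap only grows during Build, so the final heap with the deepest stack dominates every
      -- peak. Quantifying over `S` lets such bounds compose without maxima.
      space-≤  : ∀ {S} → space σ ≤ S → heap σ′ + frame * (depth σ + D) ≤ S → space σ′ ≤ S

  private
    tick-emits : ∀ {D σ} k → Emits [] k D σ (tick k σ)
    tick-emits {σ = σ} k = record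
      { size-≡ = refl ; entry-≡ = refl ; output-≡ = sym (++-identityʳ (output σ))
      ; heap-≡ = sym (ℕ.+-identityʳ (heap σ)) ; depth-≡ = refl ; time-≤ = ℕ.≤-refl ; space-≤ = λ s≤S _ → s≤S }

    emits-trans : ∀ {L M b c D σ σ′ σ″} → Emits L b D σ σ′ → Emits M c D σ′ σ″ → Emits (L ++ M) (b + c) D σ σ″
    emits-trans {L} {M} {b} {c} {D} {σ} {σ′} {σ″} p q = record
      { size-≡   = trans (q .size-≡) (p .size-≡)
      ; entry-≡  = trans (q .entry-≡) (p .entry-≡)
      ; output-≡ = trans (q .output-≡) (trans (cong (_++ M) (p .output-≡)) (++-assoc (output σ) L M))
      ; heap-≡   = begin-equality
          heap σ″                                   ≡⟨ q .heap-≡ ⟩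
          heap σ′ + 2 * length M                    ≡⟨ cong (_+ 2 * length M) (p .heap-≡) ⟩
          heap σ + 2 * length L + 2 * length M      ≡⟨ ℕ.+-assoc (heap σ) _ _ ⟩
          heap σ + (2 * length L + 2 * length M)    ≡⟨ cong (heap σ +_) (ℕ.*-distribˡ-+ 2 (length L) _) ⟨
          heap σ + 2 * (length L + length M)        ≡⟨ cong (λ l → heap σ + 2 * l) (length-++ L) ⟨
          heap σ + 2 * length (L ++ M)              ∎
      ; depth-≡  = trans (q .depth-≡) (p .depth-≡)
      ; time-≤   = begin
          time σ″            ≤⟨ q .time-≤ ⟩
          c + time σ′        ≤⟨ ℕ.+-monoʳ-≤ c (p .time-≤) ⟩
          c + (b + time σ)   ≡⟨ ℕ.+-assoc c b _ ⟨
          c + b + time σ     ≡⟨ cong (_+ time σ) (ℕ.+-comm c b) ⟩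
          b + c + time σ     ∎
      ; space-≤  = λ {S} s≤S peak≤S → q .space-≤
          (p .space-≤ s≤S (ℕ.≤-trans (ℕ.+-monoˡ-≤ (frame * (depth σ + D))
            (ℕ.≤-trans (ℕ.m≤m+n (heap σ′) (2 * length M)) (ℕ.≤-reflexive (sym (q .heap-≡))))) peak≤S))
          (subst (λ k → heap σ″ + frame * (k + D) ≤ S) (sym (p .depth-≡)) peak≤S)
      }
      where
      open Emits
      open ℕ.≤-Reasoning

    emits-weaken : ∀ {L b c D E σ σ′} → b ≤ c → D ≤ E → Emits L b D σ σ′ → Emits L c E σ σ′
    emits-weaken {σ = σ} {σ′} b≤c D≤E p = record
      { size-≡ = size-≡ ; entry-≡ = entry-≡ ; output-≡ = output-≡ ; heap-≡ = heap-≡ ; depth-≡ = depth-≡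
      ; time-≤ = ℕ.≤-trans time-≤ (ℕ.+-monoˡ-≤ (time σ) b≤c)
      ; space-≤ = λ s≤S peak≤S → space-≤ s≤S
          (ℕ.≤-trans (ℕ.+-monoʳ-≤ (heap σ′) (ℕ.*-monoʳ-≤ frame (ℕ.+-monoʳ-≤ (depth σ) D≤E))) peak≤S) }
      where open Emits p

    exec-emit : ∀ {fuel t y D σ} → Exec fuel (emit t y) σ (λ _ → Emits ((t , y) ∷ []) 1 D σ)
    exec-emit {D = D} {σ} = exec refl record
      { size-≡ = refl ; entry-≡ = refl ; output-≡ = refl ; heap-≡ = refl ; depth-≡ = refl ; time-≤ = ℕ.≤-refl
      ; space-≤ = λ s≤S peak≤S → ℕ.⊔-lub s≤S
          (ℕ.≤-trans (ℕ.+-monoʳ-≤ (heap σ + 2) (ℕ.*-monoʳ-≤ frame (ℕ.m≤m+n (depth σ) D))) peak≤S) }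

    call-emits : ∀ {L b D σ σ′} → Emits L b D (enter σ) σ′ →
                 Emits L (suc b) (suc D) σ (record σ′ { depth = depth σ })
    call-emits {L} {b} {D} {σ} {σ′} p = record
      { size-≡ = size-≡ ; entry-≡ = entry-≡ ; output-≡ = output-≡ ; heap-≡ = heap-≡ ; depth-≡ = refl
      ; time-≤ = ℕ.≤-trans time-≤ (ℕ.≤-reflexive (ℕ.+-suc b (time σ)))
      ; space-≤ = λ {S} s≤S peak≤S →
          let peak≤S′ = subst (λ k → heap σ′ + frame * k ≤ S) (ℕ.+-suc (depth σ) D) peak≤S in
          space-≤ (ℕ.⊔-lub s≤S (ℕ.≤-trans (ℕ.+-mono-≤
              (ℕ.≤-trans (ℕ.m≤m+n (heap σ) _) (ℕ.≤-reflexive (sym heap-≡)))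
              (ℕ.*-monoʳ-≤ frame (ℕ.m≤m+n (suc (depth σ)) D))) peak≤S′))
            peak≤S′ }
      where open Emits p

  module _ {σ₀ : State} (fit : Fits σ₀) where
    open Tables (entry σ₀ F) (entry σ₀ split) (entry σ₀ pivot)
    open Precondition (layout n (m + 2)) dynamic-tables inputs+deadlines using (Cell)

    -- Build writes no table, so each of its states has the tables of `σ₀`, from which the plan was
    -- read.
    Filled : State → Set
    Filled σ = size σ ≡ size σ₀ × entry σ ≡ entry σ₀

    private
      emits-filled : ∀ {L b D σ σ′} → Emits L b D σ σ′ → Filled σ → Filled σ′
      emits-filled p (size≡ , entry≡) = trans (Emits.size-≡ p) size≡ , trans (Emits.entry-≡ p) entry≡

      exec-entry : ∀ {fuel} T {i j σ v} {Q : Value (entryTy T) → State → Set} → Filled σ →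
        Cell T i j → entry σ₀ T i j ≡ v → Q v (tick 1 σ) → Exec fuel (read T i j) σ Q
      exec-entry T {i} {j} {σ} (size≡ , entry≡) c eq q = exec-read T {σ = σ}
        (subst (λ f → (i ℕ.<ᵇ proj₁ (f T)) ∧ (j ℕ.<ᵇ proj₂ (f T)) ≡ true) (sym size≡)
          (bounds fit {T} {i} {j} c))
        (trans (cong (λ f → f T i j) entry≡) eq) q

      cells : ∀ {i j} → i < j → j ≤ suc m → i < m + 2 × j < m + 2
      cells {i} {j} i<j j≤m+1 = ℕ.<-trans i<j j<m+2 , j<m+2
        where
        j<m+2 : j < m + 2
        j<m+2 = subst (j <_) (ℕ.+-comm 2 m) (s≤s j≤m+1)

      after : ∀ {fuel} {p : Code unit} {L M b c D σ σ′} → Emits L b D σ σ′ →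
        Exec fuel p σ′ (λ _ → Emits M c D σ′) → Exec fuel p σ′ (λ _ → Emits (L ++ M) (b + c) D σ)
      after p = exec-mono (emits-trans p)

    -- A call tree with l services has l + 1 empty leaves. A service costs 9 steps (6 to read the
    -- tables, 1 to emit, 2 to call), a leaf 2, and 9l + 2(l + 1) = 11l + 2.
    buildTime : List Service → ℕ
    buildTime L = 11 * length L + 2

    -- The number of services suffices both as fuel and as bound on the nesting: a node emits one
    -- service itself, so each of its calls is left with fewer.
    exec-build : ∀ {i j L} → Plan i j L → i < j → j ≤ suc m → ∀ {fuel σ} → length L ≤ fuel → Filled σ →
      Exec fuel (Algorithm.build i j) σ (λ _ → Emits L (buildTime L) (length L) σ)

    exec-call-build : ∀ {i j L} → Plan i j L → i < j → j ≤ suc m → ∀ {fuel σ} → length L ≤ fuel → Filled σ →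
      Exec (suc fuel) (call i j) σ (λ _ → Emits L (suc (buildTime L)) (suc (length L)) σ)
    exec-call-build plan i<j j≤m+1 L≤fuel filled =
      exec-call (exec-mono call-emits (exec-build plan i<j j≤m+1 L≤fuel filled))

    exec-build {i} {j} (empty κ≡ _ _) i<j j≤m+1 _ filled =
      exec-bind $ exec-entry split filled cell κ≡ $
      exec-bind $ exec-entry pivot filled cell refl $ exec refl (tick-emits 2)
      where
      cell : i < m + 2 × j < m + 2
      cell = cells i<j j≤m+1
    exec-build {i} {j} (serve {k = k} {p} {t} {L} {M} κ≡ π≡ served _ left right) i<j j≤m+1
      {fuel} {σ} L<fuel filled =
      exec-bind $ exec-entry split filled cell κ≡ $
      exec-bind $ exec-entry pivot filled cell π≡ $
      exec-bind $ exec-bind $ exec refl $ exec-entry τ filled τ-cell (trans (kept fit τ-cell refl) Tk≡t) $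
      exec-bind $ exec-bind $ exec refl $ exec-entry loc filled (ℕ.z<s , p<n) (kept fit (ℕ.z<s , p<n) refl) $
      body fuel (subst (_≤ fuel) total L<fuel)
      where
      open Serves served
      cell : i < m + 2 × j < m + 2
      cell = cells i<j j≤m+1

      k≤m+1 : k ≤ suc m
      k≤m+1 = ℕ.≤-trans (ℕ.<⇒≤ k<j) j≤m+1

      τ-cell : Cell τ 0 k
      τ-cell = ℕ.z<s , ℕ.≤-trans (proj₂ (cells i<k k≤m+1)) (ℕ.+-monoˡ-≤ 2 (Sorted.m≤n sorted))

      total : length (L ++ (t , x p) ∷ M) ≡ length L + suc (length M)
      total = length-++ L

      time-≡ : ∀ l r → 6 + (suc (11 * l + 2) + (1 + suc (11 * r + 2))) ≡ 11 * (l + suc r) + 2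
      time-≡ = solve 2 (λ l r → con 6 :+
        ((con 1 :+ (con 11 :* l :+ con 2)) :+ (con 1 :+ (con 1 :+ (con 11 :* r :+ con 2))))
        := con 11 :* (l :+ (con 1 :+ r)) :+ con 2) refl
        where open +-*-Solver

      σ₁ : State
      σ₁ = tick 1 (tick 1 (tick 1 (tick 1 (tick 1 (tick 1 σ)))))

      body : ∀ fuel → length L + suc (length M) ≤ fuel →
        Exec fuel (call i k >> (emit t (x p) >> call k j)) σ₁
          (λ _ → Emits (L ++ (t , x p) ∷ M)
            (buildTime (L ++ (t , x p) ∷ M)) (length (L ++ (t , x p) ∷ M)) σ)
      body zero       h = contradiction (subst (_≤ 0) (ℕ.+-suc (length L) (length M)) h) λ ()
      body (suc fuel) h = exec-mono (emits-weaken
          (ℕ.≤-reflexive (trans (time-≡ (length L) (length M)) (cong (λ l → 11 * l + 2) (sym total))))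
          (ℕ.≤-reflexive (sym total))) $
        after (tick-emits 6) $
        exec-bind $ exec-mono
          (λ p → after (emits-weaken ℕ.≤-refl (subst (_≤ length L + suc (length M)) (ℕ.+-comm (length L) 1)
                          (ℕ.+-monoʳ-≤ (length L) (s≤s z≤n))) p) $
            exec-bind $ exec-mono
              (λ q → after q $
                exec-mono (emits-weaken ℕ.≤-refl (ℕ.m≤n+m (suc (length M)) (length L))) $
                exec-call-build right k<j j≤m+1 (ℕ.≤-trans (ℕ.m≤n+m (length M) (length L)) fits)
                  (emits-filled q (emits-filled p filled)))
              exec-emit) $
          exec-call-build left i<k k≤m+1 (ℕ.≤-trans (ℕ.m≤m+n (length L) (length M)) fits) filled
        where
        fits : length L + length M ≤ fuel
        fits = ℕ.s≤s⁻¹ (subst (_≤ suc fuel) (ℕ.+-suc (length L) (length M)) h)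

-- The whole program

module Correctness (R : OrderedGroup) {n : ℕ} (I : LAD.Instance R n) (choice : ℕ → Bool) where
  open LAD R
  open Semantics R
  open Logic R
  open Executions choice Algorithm.build

  allocated : (T : Table) → ℕ → ℕ → Value (entryTy T) → State → State
  allocated T r c v σ = record-space (tick (suc (r * c)) (record σ
    { size = setSize T (r , c) (size σ) ; entry = setAll T v (entry σ)
    ; heap = heap σ + words (entryTy T) * (r * c) }))

  record Usage (t h : ℕ) (σ : State) : Set where
    field
      time-≤   : time σ ≤ t
      heap-≤   : heap σ ≤ h
      space-≤  : space σ ≤ h + frame * 1
      depth-≡  : depth σ ≡ 1
      output-≡ : output σ ≡ []

  open Usage

  private
    N : ℕ
    N = n + 2

    open Durations R {n} {n + 2} (ℕ.m≤m+n n 2)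

    n≤N : n ≤ N
    n≤N = ℕ.m≤m+n n 2

    usage-tick : ∀ k {t h σ} → Usage t h σ → Usage (k + t) h (tick k σ)
    usage-tick k u = record { time-≤ = ℕ.+-monoʳ-≤ k (u .time-≤) ; heap-≤ = u .heap-≤ ; space-≤ = u .space-≤
      ; depth-≡ = u .depth-≡ ; output-≡ = u .output-≡ }

    usage-quiet : ∀ {b t h σ σ′} → Usage t h σ → Quiet b σ σ′ → Usage (b + t) h σ′
    usage-quiet {b} u q = record
      { time-≤   = ℕ.≤-trans (Quiet.time-≤ q) (ℕ.+-monoʳ-≤ b (u .time-≤))
      ; heap-≤   = subst (_≤ _) (sym (Quiet.heap-≡ q)) (u .heap-≤)
      ; space-≤  = subst (_≤ _) (sym (Quiet.space-≡ q)) (u .space-≤)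
      ; depth-≡  = trans (Quiet.depth-≡ q) (u .depth-≡)
      ; output-≡ = trans (Quiet.output-≡ q) (u .output-≡) }

    -- Replacing the actual size, which depends on m, by a bound in N makes the accumulated
    -- expressions agree with `timeBound` and `heapBound` by computation.
    usage-alloc : ∀ T r c {s v t h σ} → r * c ≤ s → Usage t h σ →
      Usage (suc s + t) (h + words (entryTy T) * s) (allocated T r c v σ)
    usage-alloc T r c {s} {h = h} {σ} rc≤s u = record
      { time-≤   = ℕ.+-mono-≤ (s≤s rc≤s) (u .time-≤)
      ; heap-≤   = heap≤
      ; space-≤  = ℕ.⊔-lub
          (ℕ.≤-trans (u .space-≤) (ℕ.+-monoˡ-≤ (frame * 1) (ℕ.m≤m+n h _)))
          (ℕ.+-mono-≤ heap≤ (ℕ.≤-reflexive (cong (frame *_) (u .depth-≡))))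
      ; depth-≡  = u .depth-≡
      ; output-≡ = u .output-≡ }
      where
      heap≤ : heap σ + words (entryTy T) * (r * c) ≤ h + words (entryTy T) * s
      heap≤ = ℕ.+-mono-≤ (u .heap-≤) (ℕ.*-monoʳ-≤ (words (entryTy T)) rc≤s)

    usage-initial : Usage 0 (3 * N) (initial I)
    usage-initial = record { time-≤ = z≤n ; heap-≤ = 3n≤3N ; space-≤ = ℕ.+-monoˡ-≤ frame 3n≤3N
      ; depth-≡ = refl ; output-≡ = refl }
      where
      3n≤3N : 3 * n ≤ 3 * N
      3n≤3N = ℕ.*-monoʳ-≤ 3 n≤N

    in-bounds : ∀ {i j r c} → i < r × j < c → (i ℕ.<ᵇ r) ∧ (j ℕ.<ᵇ c) ≡ true
    in-bounds (i<r , j<c) = cong₂ _∧_ (<ᵇ-true i<r) (<ᵇ-true j<c)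
      where
      <ᵇ-true : ∀ {i j} → i < j → (i ℕ.<ᵇ j) ≡ true
      <ᵇ-true {zero}  (s≤s _)   = refl
      <ᵇ-true {suc i} (s≤s i<j) = <ᵇ-true i<j

    1*-≤ : ∀ {c s} → c ≤ s → 1 * c ≤ s
    1*-≤ {c} c≤s = subst (_≤ _) (sym (ℕ.*-identityˡ c)) c≤s

  σ₁ : State
  σ₁ = allocated rank 1 n 0 $ tick 1 $ allocated τ 1 N ⊥± $ tick 5 $ initial I

  module _ where
    open Sorting R I
    open Soundness (layout n 0) sorted-tables inputs

    σ₁-fits : Fits σ₁
    σ₁-fits = record { bounds = λ {T} → bounds T ; kept = λ {T} _ → kept T }
      where
      open Precondition (layout n 0) sorted-tables inputs
      bounds : ∀ T {i j} → Cell T i j → inBounds σ₁ T i j ≡ true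
      bounds rel   = in-bounds
      bounds loc   = in-bounds
      bounds dl    = in-bounds
      bounds τ     = in-bounds
      bounds rank  = in-bounds
      bounds mark  (_ , ())
      bounds F     (() , _)
      bounds split (() , _)
      bounds pivot (() , _)

      kept : ∀ T {i j} → sorted-tables T ≡ false → entry σ₁ T i j ≡ inputs T i j
      kept rel   _ = refl
      kept loc   _ = refl
      kept dl    _ = refl
      kept mark  _ = refl
      kept F     _ = refl
      kept split _ = refl
      kept pivot _ = refl

  Post : OrderedGroup.Carrier R → State → Set
  Post v σ = IsOptimal I (output σ) × v ≡ cost (output σ) × time σ ≤ timeBound N × space σ ≤ spaceBound N


  -- The rest of `lad` once sorting has returned `m`, with the earlier registers replaced by their
  -- values.
  afterSorting : ℕ → Code num
  afterSorting m = do
    m+1 ← add m 1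
    m+2 ← add m 2
    zeroᵛ ← zeroⱽ
    alloc₁ mark m+2 false
    alloc F m+2 m+2 zeroᵛ
    alloc split m+2 m+2 nothing
    alloc pivot m+2 m+2 nothing
    for 1 m+2 λ w → do
      hi ← sub m+2 w
      for 0 hi λ i → do
        j ← add i w
        fill n i j
    v ← read F 0 m+1
    call 0 m+1
    ret v
    where open Algorithm

  module AfterSorting {m : ℕ} {σ₂ : State}
    (sorted : Subproblems.Sorted R I m (entry σ₂ τ 0) (entry σ₂ rank 0))
    (fit : Soundness.Fits (layout n 0) (Sorting.sorted-tables R I) (Sorting.inputs R I) σ₂)
    (size-≡ : size σ₂ ≡ size σ₁) 
    (usage : Usage (sortBound N + ((1 + N) + (1 + ((1 + N) + 5)))) (3 * N + 1 * N + 1 * N) σ₂) where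
    open Subproblems R I
    open Sorted sorted
    open WithDeadlines sorted
    open Filling R I sorted
    open Soundness (layout n (m + 2)) dynamic-tables inputs+deadlines

    σ₃ : State
    σ₃ = allocated pivot (m + 2) (m + 2) nothing $ allocated split (m + 2) (m + 2) nothing $
         allocated F (m + 2) (m + 2) (OrderedGroup.0# R) $ allocated mark 1 (m + 2) false $ tick 4 σ₂

    σ₃-fits : Fits σ₃
    σ₃-fits = record { bounds = λ {T} → bounds T ; kept = λ {T} → kept T }
      where
      open Precondition (layout n (m + 2)) dynamic-tables inputs+deadlines

      earlier : ∀ T {i j b} → (i ℕ.<ᵇ proj₁ (size σ₁ T)) ∧ (j ℕ.<ᵇ proj₂ (size σ₁ T)) ≡ b → inBounds σ₂ T i j ≡ b
      earlier T {i} {j} {b} =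
        subst (λ f → (i ℕ.<ᵇ proj₁ (f T)) ∧ (j ℕ.<ᵇ proj₂ (f T)) ≡ b) (sym size-≡)

      bounds : ∀ T {i j} → Cell T i j → inBounds σ₃ T i j ≡ true
      bounds rel   c = earlier rel (in-bounds c)
      bounds loc   c = earlier loc (in-bounds c)
      bounds dl    c = earlier dl (in-bounds c)
      bounds τ     c = earlier τ (in-bounds c)
      bounds rank  c = earlier rank (in-bounds c)
      bounds mark  c = in-bounds c
      bounds F     c = in-bounds c
      bounds split c = in-bounds c
      bounds pivot c = in-bounds c

      kept : ∀ T {i j} → Cell T i j → dynamic-tables T ≡ false → entry σ₃ T i j ≡ inputs+deadlines T i j
      kept rel  c _ = Soundness.Fits.kept fit {rel} c refl
      kept loc  c _ = Soundness.Fits.kept fit {loc} c refl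
      kept dl   c _ = Soundness.Fits.kept fit {dl} c refl
      -- Being a cell forces row 0, the row from which the sorted deadlines were taken; `rank` is
      -- treated alike.
      kept τ    (s≤s z≤n , _) _ = refl
      kept rank (s≤s z≤n , _) _ = refl

    -- Since τ_0 = -∞ and τ_(m+1) = +∞, the interval (0, m + 1) contains every request; its optimum
    -- is that of the instance.
    whole : ∀ {r} → r < n → In 0 (m + 1) r
    whole r<n = subst (_<± [ a _ ]) (sym first) Strict.⊥±<[ a _ ] ,
                subst ([ d _ ] <±_) (sym (trans (cong (entry σ₂ τ 0) (ℕ.+-comm m 1)) last)) Strict.[ d _ ]<⊤±
      where open Numbers R using (_<±_)

    m+1≤1+m : m + 1 ≤ suc m
    m+1≤1+m = ℕ.≤-reflexive (ℕ.+-comm m 1)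

    module _ {e : Memory} (solved : ∀ i j → i < j → j ≤ suc m → SolvedIn e i j) where
      open Tables (e F) (e split) (e pivot)

      plan-optimal : ∀ {L} → Plan 0 (m + 1) L → IsOptimal I L
      plan-optimal {L} plan-L = record
        { isFeasible = record
          { isSolution = record
            { distinct    = AllPairs.map (λ t<t′ s≡s′ → proj₂ t<t′ (cong proj₁ s≡s′))
                              (plan-ordered m+1≤1+m plan-L)
            ; locations≥0 = plan-nonneg plan-L }
          ; covered = all-columns I (CoveredBy L) λ r<n → plan-covers plan-L r<n (whole r<n) }
        ; minimum = λ S feasible → subst (λ c → OrderedGroup._≤_ R c (cost S)) (sym (plan-cost plan-L))
            (lowerBound (solved 0 (m + 1) (ℕ.m≤n+m 1 m) m+1≤1+m)
              (IsSolution.locations≥0 (IsFeasible.isSolution feasible))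
              (λ r<n _ → column-lookup {P = CoveredBy S} (IsFeasible.covered feasible) r<n)) }


    private
      m+2≤N : m + 2 ≤ N
      m+2≤N = ℕ.+-monoˡ-≤ 2 m≤n

      square : (m + 2) * (m + 2) ≤ N * N
      square = ℕ.*-mono-≤ m+2≤N m+2≤N

    usage₃ : Usage _ _ σ₃
    usage₃ = usage-alloc pivot (m + 2) (m + 2) square $ usage-alloc split (m + 2) (m + 2) square $
             usage-alloc F (m + 2) (m + 2) square $ usage-alloc mark 1 (m + 2) (1*-≤ m+2≤N) $ usage-tick 4 usage

    -- The fuel covers the outer call of Build and at most n levels below it, one per service.
    exec-afterSorting : Exec (suc n) (afterSorting m) σ₂ Post
    exec-afterSorting =
      exec-bind $ exec refl $ exec-bind $ exec refl $ exec-bind $ exec refl $ exec-bind $ exec refl $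
      exec-bind $ exec refl $ exec-bind $ exec refl $ exec-bind $ exec {final = σ₃} refl $
      exec-bind $ exec-mono (λ {_} {σ₄} (solved , fit , quiet) → filled σ₄ solved fit quiet) $
      exec-wp {p = fillAll} (fillAll-within m+2≤N) {Q = λ _ e → ∀ i j → i < j → j ≤ suc m → SolvedIn e i j}
        σ₃-fits wp-fillAll
      where
      filled : ∀ σ₄ → (∀ i j → i < j → j ≤ suc m → SolvedIn (entry σ₄) i j) → Fits σ₄ →
        Quiet (fillAllBound N) σ₃ σ₄ →
        Exec (suc n) (read F 0 (m + 1) >>= λ v → call 0 (m + 1) >> ret v) σ₄ Post
      filled σ₄ solved fit₄ quiet with Tables.plan _ _ _ (λ {i} {j} → solved i j) (ℕ.m≤n+m 1 m) m+1≤1+m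
      ... | L , plan-L = exec-bind $ exec-read F {σ = σ₄} (Fits.bounds fit₄ {F} below) refl $
        exec-bind $ exec-mono
          (λ {_} {σ₅} emits → exec refl (post σ₅ emits)) $
        B.exec-call-build fit₄ plan-L (ℕ.m≤n+m 1 m) m+1≤1+m {σ = tick 1 σ₄} L≤n (refl , refl)
        where
        module B = Building R I sorted choice
        open B.Emits

        below : 0 < m + 2 × m + 1 < m + 2
        below = ℕ.≤-trans ℕ.z<s (ℕ.m≤n+m 2 m) , ℕ.+-monoʳ-< m ℕ.≤-refl

        L≤n : length L ≤ n
        L≤n = ℕ.≤-trans (ℕ.s≤s⁻¹ (subst₂ _<_ (ℕ.+-identityʳ (length L)) (ℕ.+-comm m 1)
          (Tables.plan-length _ _ _ (ℕ.m≤n+m 1 m) plan-L))) m≤n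

        L≤N : length L ≤ N
        L≤N = ℕ.≤-trans L≤n n≤N

        usage₄ : Usage _ _ (tick 1 σ₄)
        usage₄ = usage-tick 1 (usage-quiet usage₃ quiet)

        post : ∀ σ₅ → B.Emits L (suc (B.buildTime fit₄ L)) (suc (length L)) (tick 1 σ₄) σ₅ →
               Post (entry σ₄ F 0 (m + 1)) σ₅
        post σ₅ emits =
          subst (IsOptimal I) (sym output≡L) (plan-optimal {entry σ₄} solved plan-L) ,
          trans (sym (Tables.plan-cost _ _ _ plan-L)) (cong cost (sym output≡L)) ,
          ℕ.≤-trans (emits .time-≤)
            (ℕ.+-mono-≤ (s≤s (ℕ.+-monoˡ-≤ 2 (ℕ.*-monoʳ-≤ 11 L≤N))) (usage₄ .Usage.time-≤)) ,
          emits .space-≤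
            (ℕ.≤-trans (usage₄ .Usage.space-≤)
              (ℕ.+-mono-≤ (ℕ.m≤m+n (heapBound N) (2 * N)) (ℕ.*-monoʳ-≤ frame {1} {2 + N} (s≤s z≤n))))
            (ℕ.+-mono-≤
              (ℕ.≤-trans (ℕ.≤-reflexive (emits .heap-≡))
                (ℕ.+-mono-≤ (usage₄ .Usage.heap-≤) (ℕ.*-monoʳ-≤ 2 L≤N)))
              (ℕ.*-monoʳ-≤ frame (ℕ.+-mono-≤ (ℕ.≤-reflexive (usage₄ .Usage.depth-≡)) (s≤s L≤N))))
          where
          output≡L : output σ₅ ≡ L
          output≡L = trans (emits .output-≡) (cong (_++ L) (usage₄ .Usage.output-≡))

  exec-lad : Exec (suc n) (Algorithm.lad n) (initial I) Post
  exec-lad =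
    exec-bind $ exec refl $ exec-bind $ exec refl $ exec-bind $ exec refl $ exec-bind $ exec refl $
    exec-bind $ exec refl $ exec-bind $ exec {final = σ₁} refl $
    exec-bind $ exec-mono
      (λ {m} {σ₂} (sorted , fit , quiet) →
        AfterSorting.exec-afterSorting {m} {σ₂} sorted fit (Quiet.size-≡ quiet) (usage-quiet usage₁ quiet)) $
    Soundness.exec-wp (layout n 0) sorted-tables inputs sortDeadlines-within
      {Q = λ m e → Subproblems.Sorted R I m (e τ 0) (e rank 0)} σ₁-fits wp-sortDeadlines
    where
    open Sorting R I

    usage₁ : Usage _ _ σ₁
    usage₁ = usage-alloc rank 1 n (1*-≤ n≤N) $ usage-tick 1 $
             usage-alloc τ 1 N (1*-≤ ℕ.≤-refl) $ usage-tick 5 usage-initial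

theorem6p3 : ∃[ c ] (∀ (R : OrderedGroup) → let open Execution R in
    ∀ (n : ℕ) (I : Instance n) (choice : ℕ → Bool) →
    ∃[ v ] ∃[ σ ] ((choice ⊢ I ⇓ v , σ)
    × IsOptimal I (output σ)
    × v ≡ cost (output σ)
    × (1 ≤ n → time σ ≤ c * n ^ 3 × space σ ≤ c * n ^ 2)))
theorem6p3 = 3348 , λ R n I choice → conclude R n I choice (Correctness.exec-lad R I choice)
  where
  conclude : ∀ R n I choice → let open Execution R in
    Logic.Executions.Exec R choice Algorithm.build (suc n) (Algorithm.lad n) (initial I)
      (Correctness.Post R I choice) →
    ∃[ v ] ∃[ σ ] ((choice ⊢ I ⇓ v , σ)
    × IsOptimal I (output σ)
    × v ≡ cost (output σ)
    × (1 ≤ n → time σ ≤ 3348 * n ^ 3 × space σ ≤ 3348 * n ^ 2))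
  conclude R n I choice (Logic.Executions.exec run-≡ (optimal , v≡cost , time≤ , space≤)) =
    _ , _ , (suc n , run-≡) , optimal , v≡cost , λ 1≤n →
      ℕ.≤-trans time≤ (timeBound-cubic 1≤n) ,
      -- One constant serves both bounds: 1845 + 1503 = 3348.
      ℕ.≤-trans space≤ (ℕ.≤-trans (spaceBound-quadratic 1≤n) (ℕ.*-monoˡ-≤ (n ^ 2) (ℕ.m≤m+n 1845 1503)))
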